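{- For $1\le n\le 20$, the set $E(n)$ of integers $\ell\geq 1$ with $\Delta_\ell(n)<0$ is as follows: $E(1)=\{\ell\ge 2\}$; $E(2)=\emptyset$; $E(3)=\{2\le\ell\le 13\}$; $E(4)=\{\ell\ge 16\}$; $E(5)=\{2\le \ell\le 19\}$; $E(6)=\emptyset$; $E(7)=\{\ell\ge 2\}$; $E(8)=\{15\le\ell\le 26\}$; $E(9)=\{2\le\ell\le 12\}$; $E(10)=\{\ell\ge 22\}$; $E(11)=\{2\le\ell\le 35\}$; $E(12)=\emptyset$; $E(13)=\{2\le \ell\le 9\}\cup\{\ell\ge 26\}$; $E(14)=\{20\le\ell\le 44\}$; $E(15)=\{2\le\ell\le 8\}$; $E(16)=\{\ell\ge 29\}$; $E(17)=\{2\le\ell\le 6\}\cup\{24\le\ell\le 54\}$; $E(18)=\emptyset$; $E(19)=\{2\le\ell\le 4\}\cup\{\ell\ge 32\}$; $E(20)=\{\ell\ge 27\}$.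
   Context: For integers $\ell\geq 1$ and $n\geq 1$, let $C_{\ell,n}=\{(\pi_1,\dots,\pi_\ell)\in S_n^\ell : \pi_j\pi_k=\pi_k\pi_j \text{ for all } j,k\}$, where $S_n$ is the symmetric group on $n$ letters, and $N_\ell(n)=|C_{\ell,n}|/n!$, with $N_\ell(0)=1$. Define $\Delta_\ell(n)=N_\ell(n)^2-N_\ell(n-1)N_\ell(n+1)$. -}

module Defs where

open import Data.Nat using (ℕ; zero; suc; _∸_; _≤_; _!)
open import Data.Nat.Properties using (_!≢0)
open import Data.Fin using (Fin; _≟_)
open import Data.List using (List; []; _∷_; map; concatMap; filter; length; allFin)
import Data.List.Relation.Unary.All as ListAll
open import Data.Vec using (Vec; []; _∷_; lookup; tabulate; toList)
open import Data.Vec.Properties using (≡-dec)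
open import Data.List.Relation.Unary.Unique.Propositional using (Unique)
import Data.List.Relation.Unary.Unique.DecPropositional as UniqueDec
open import Data.Integer using (+_)
open import Data.Rational using (ℚ; _/_; _*_; _-_; 1ℚ)
open import Data.Empty using (⊥)
open import Data.Unit using (⊤)
open import Data.Sum using (_⊎_)
open import Data.Product using (_×_)
open import Relation.Binary.PropositionalEquality using (_≡_)
open import Relation.Nullary using (Dec)
open import Relation.Unary using (Decidable)

vecsOver : {A : Set} → List A → (ℓ : ℕ) → List (Vec A ℓ)
vecsOver xs zero    = [] ∷ []
vecsOver xs (suc ℓ) = concatMap (λ x → map (x ∷_) (vecsOver xs ℓ)) xs

-- A permutation of Fin n is represented by its table of values
-- (π 0, …, π (n-1)); a map Fin n → Fin n is a permutation iff it is injective.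
Perm : ℕ → Set
Perm n = Vec (Fin n) n

_∘ₚ_ : ∀ {n} → Perm n → Perm n → Perm n
π ∘ₚ σ = tabulate (λ i → lookup π (lookup σ i))

Sym : (n : ℕ) → List (Perm n)
Sym n = filter (λ v → U.unique? (toList v)) (vecsOver (allFin n) n)
  where module U = UniqueDec (_≟_ {n})

Commuting : ∀ {ℓ n} → Vec (Perm n) ℓ → Set
Commuting {ℓ} t =
  ListAll.All (λ j → ListAll.All (λ k →
    (lookup t j ∘ₚ lookup t k) ≡ (lookup t k ∘ₚ lookup t j)) (allFin ℓ)) (allFin ℓ)

commuting? : ∀ {ℓ n} → Decidable (Commuting {ℓ} {n})
commuting? {ℓ} t =
  ListAll.all? (λ j → ListAll.all? (λ k →
    ≡-dec _≟_ (lookup t j ∘ₚ lookup t k) (lookup t k ∘ₚ lookup t j)) (allFin ℓ)) (allFin ℓ)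

C : (ℓ n : ℕ) → List (Vec (Perm n) ℓ)
C ℓ n = filter commuting? (vecsOver (Sym n) ℓ)

N : (ℓ n : ℕ) → ℚ
N ℓ zero    = 1ℚ
N ℓ (suc n) = (+ length (C ℓ (suc n)) / (suc n) !) {{(suc n) !≢0}}

-- Δ_ℓ(n) = N_ℓ(n)^2 - N_ℓ(n-1) N_ℓ(n+1)   (used for n ≥ 1).
Δ : (ℓ n : ℕ) → ℚ
Δ ℓ n = N ℓ n * N ℓ n - N ℓ (n ∸ 1) * N ℓ (suc n)

-- The claimed sets E(n) ⊆ {ℓ ≥ 1} for 1 ≤ n ≤ 20 (membership predicate E n ℓ).
-- Values for n outside 1..20 are irrelevant (set to ∅).
E : ℕ → ℕ → Set
E 1  ℓ = 2 ≤ ℓ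
E 2  ℓ = ⊥
E 3  ℓ = 2 ≤ ℓ × ℓ ≤ 13
E 4  ℓ = 16 ≤ ℓ
E 5  ℓ = 2 ≤ ℓ × ℓ ≤ 19
E 6  ℓ = ⊥
E 7  ℓ = 2 ≤ ℓ
E 8  ℓ = 15 ≤ ℓ × ℓ ≤ 26
E 9  ℓ = 2 ≤ ℓ × ℓ ≤ 12
E 10 ℓ = 22 ≤ ℓ
E 11 ℓ = 2 ≤ ℓ × ℓ ≤ 35
E 12 ℓ = ⊥
E 13 ℓ = (2 ≤ ℓ × ℓ ≤ 9) ⊎ 26 ≤ ℓ
E 14 ℓ = 20 ≤ ℓ × ℓ ≤ 44
E 15 ℓ = 2 ≤ ℓ × ℓ ≤ 8
E 16 ℓ = 29 ≤ ℓ
E 17 ℓ = (2 ≤ ℓ × ℓ ≤ 6) ⊎ (24 ≤ ℓ × ℓ ≤ 54)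
E 18 ℓ = ⊥
E 19 ℓ = (2 ≤ ℓ × ℓ ≤ 4) ⊎ 32 ≤ ℓ
E 20 ℓ = 27 ≤ ℓ
E _  ℓ = ⊥

{-# OPTIONS --safe #-}
module Submission where

-- Sorting the pairs (commuting ℓ-tuple on n points, marked point) by the stabiliser
-- of the marked point, a sublattice of ℤ^ℓ of index d, gives
--   n · |C ℓ n| = Σ_d g ℓ d · n (n − 1) ⋯ (n − d + 1) · |C ℓ (n − d)|,
-- where g ℓ d counts the sublattices of index d and g (ℓ + 1) d = Σ_{e ∣ d} e · g ℓ e.
-- Hence |C ℓ n| is, for each n, an explicit combination of exponentials b^ℓ.  The sign
-- of Δ is computed for ℓ ≤ 54; from ℓ = 55 on, for every n ≤ 20, the leading
-- exponential outweighs all the others together.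

open import Defs
open import Data.Bool using (Bool; true; false; if_then_else_; T; _∧_; not)
open import Data.Bool.Properties using (T-∧; T-≡)
open import Data.Empty using (⊥)
open import Data.Fin as Fin using (Fin; zero; suc; toℕ; fromℕ; inject₁; _≟_; punchIn; punchOut; combine)
import Data.Fin.Properties as Finₚ
open import Data.Fin.Relation.Unary.Top using (view; view-fromℕ; view-inject₁; ‵fromℕ; ‵inject₁)
open import Data.Integer as ℤ using (ℤ; +_; -[1+_]; 0ℤ; _+_; _*_; -_; ∣_∣; +<+; -<+)
import Data.Integer.Properties as ℤₚ
import Data.Integer.Solver as ℤSolver
open import Data.List as List using (List; []; _∷_; map; concatMap; length; null; allFin; cartesianProduct)
import Data.List.Properties as Listₚ
open import Data.List.Membership.Propositional using (_∈_; find; lose)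
open import Data.List.Membership.Propositional.Properties
open import Data.List.Membership.Propositional.Properties.WithK using (unique∧set⇒bag)
open import Data.List.Relation.Binary.BagAndSetEquality using (∼bag⇒↭)
open import Data.List.Relation.Binary.Permutation.Propositional.Properties using (↭-length)
open import Data.List.Relation.Binary.Pointwise as Pointwise using (Pointwise; []; _∷_; Pointwise-length)
open import Data.List.Relation.Unary.All as All using ([]; _∷_)
open import Data.List.Relation.Unary.AllPairs using ([]; _∷_)
open import Data.List.Relation.Unary.Any using (here)
open import Data.List.Relation.Unary.Unique.Propositional using (Unique)
import Data.List.Relation.Unary.Unique.Propositional.Properties as Uniqueₚ
open import Data.Nat as ℕ using (ℕ; zero; suc; s≤s; z≤n; _≤_; _∸_; _≡ᵇ_; _<ᵇ_; _≤ᵇ_; _!)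
open import Data.Nat.GeneralisedArithmetic using (fold; fold-+)
open import Data.Nat.ListAction using () renaming (sum to sumℕ)
open import Data.Nat.ListAction.Properties using (sum-++)
import Data.Nat.Properties as ℕₚ
open import Data.Nat.Properties using (_!≢0)
import Data.Nat.Solver as ℕSolver
open import Data.Product using (_×_; _,_; proj₁; proj₂; ∃; uncurry)
open import Data.Rational as ℚ using (ℚ; _<_; 0ℚ; toℚᵘ)
import Data.Rational.Properties as ℚₚ
open import Data.Rational.Unnormalised as ℚᵘ using (mkℚᵘ; *≡*; *<*)
import Data.Rational.Unnormalised.Properties as ℚᵘₚ
open import Data.Sum as Sum using (_⊎_; inj₁; inj₂)
open import Data.Sum.Function.Propositional using (_⊎-⇔_)
open import Data.Sum.Properties using (inj₁-injective; inj₂-injective)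
open import Data.Unit using (⊤; tt)
open import Data.Vec using (Vec; []; _∷_; lookup; tabulate; toList; replicate)
import Data.Vec.Properties as Vecₚ
import Data.Vec.Relation.Unary.All.Properties as VecAllₚ
open import Function using (_∘_; id; case_of_; _⇔_; mk⇔; Equivalence)
open import Relation.Binary using (tri<; tri≈; tri>)
open import Relation.Binary.PropositionalEquality
open import Relation.Nullary using (¬_; Dec; yes; no; does; contradiction)
open import Relation.Nullary.Decidable using (¬?; map′; decidable-stable; _×-dec_; _⊎-dec_; from-yes; T?)
open import Algebra.Properties.Semiring.Sum ℕₚ.+-*-semiring using (sum; sum-cong-≗; ∑-comm; *-distribˡ-sum; *-distribʳ-sum)

-- Commutativity makes the count possible: all points of an orbit share one stabiliser Λ, and the
-- orbit is ℤ^ℓ / Λ acting on itself by translations. Marking a point fixes the identification with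
-- the quotient, so only the places of the d cosets and a commuting tuple on the complement remain
-- to be chosen. The factor e in the recurrence for g arises as follows. A sublattice of ℤ^(ℓ + 1)
-- is given by its part in ℤ^ℓ, of index e, by the least power k + 1 of the new generator that is
-- congruent to an element of ℤ^ℓ, and by one of e cosets; its index is d = (k + 1) · e. The matrix
-- of this recurrence is triangular with diagonal 1, 2, 3, ..., and these distinct eigenvalues are
-- the bases of the exponentials. The coefficients are rational, hence the scaling by powers of
-- 5040. The list `C ℓ n` is far too long to evaluate, so every computation goes through the
-- recurrence.

-- Commuting families of maps and their iterates

Gens : ℕ → Set → Set
Gens ℓ X = Fin ℓ → X → X

Commute : ∀ {ℓ X} → Gens ℓ X → Set
Commute f = ∀ j k x → f j (f k x) ≡ f k (f j x)

Inj : {A B : Set} → (A → B) → Set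
Inj φ = ∀ {x y} → φ x ≡ φ y → x ≡ y

Surj : {A B : Set} → (A → B) → Set
Surj φ = ∀ y → ∃ λ x → φ x ≡ y

Natural : ∀ {ℓ X Y} → (X → Y) → Gens ℓ X → Gens ℓ Y → Set
Natural φ f g = ∀ j x → φ (f j x) ≡ g j (φ x)

fold-natural : ∀ {X Y : Set} (φ : X → Y) {s : X → X} {r : Y → Y} →
               (∀ x → φ (s x) ≡ r (φ x)) → ∀ n x → φ (fold x s n) ≡ fold (φ x) r n
fold-natural φ nat zero    x = refl
fold-natural φ {r = r} nat (suc n) x = trans (nat _) (cong r (fold-natural φ nat n x))

fold-inj : ∀ {X : Set} {s : X → X} → Inj s → ∀ n → Inj (λ x → fold x s n)
fold-inj inj zero    eq = eq
fold-inj inj (suc n) eq = fold-inj inj n (inj eq)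

fold-surj : ∀ {X : Set} {s : X → X} → Surj s → ∀ n → Surj (λ x → fold x s n)
fold-surj sur zero    y = y , refl
fold-surj {s = s} sur (suc n) y with sur y
... | z , eq with fold-surj sur n z
... | x , eq′ = x , trans (cong s eq′) eq

-- Sublattices of finite index of ℤ^ℓ in Hermite normal form: with σ the newest
-- generator, `ext Λ k v` adds to the relations of Λ the relation σ^(k+1) = v,
-- where v is a coset of Λ.  `Q Λ` is the quotient ℤ^ℓ / Λ.
mutual
  data Lat : ℕ → Set where
    pt  : Lat 0
    ext : ∀ {ℓ} (Λ : Lat ℓ) (k : ℕ) → Q Λ → Lat (suc ℓ)

  Q : ∀ {ℓ} → Lat ℓ → Set
  Q pt          = ⊤
  Q (ext Λ k _) = Fin (suc k) × Q Λ

-- The translation action on the quotient by a sublattice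

origin : ∀ {ℓ} (Λ : Lat ℓ) → Q Λ
origin pt          = tt
origin (ext Λ k v) = zero , origin Λ

-- A coset is read as its reduced representative, one exponent per generator, and that
-- representative is applied to `x`.
word : ∀ {ℓ X} (Λ : Lat ℓ) → Gens ℓ X → Q Λ → X → X
word pt          f q       x = x
word (ext Λ k v) f (a , q) x = fold (word Λ (f ∘ suc) q x) (f zero) (toℕ a)

-- An odometer on reduced representatives: raising the newest exponent past `k` resets it to zero
-- and carries `v` into the older coordinates.
gen : ∀ {ℓ} (Λ : Lat ℓ) → Gens ℓ (Q Λ)
gen (ext Λ k v) (suc i) (a , q) = a , gen Λ i q
gen (ext Λ k v) zero    (a , q) with view a
... | ‵fromℕ     = zero , word Λ (gen Λ) v q
... | ‵inject₁ b = suc b , q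

-- Λ is the stabiliser of i in the action of ℤ^ℓ given by f.
Fits : ∀ {ℓ X} → Lat ℓ → Gens ℓ X → X → Set
Fits pt          f i = ⊤
Fits (ext Λ k v) f i =
    Fits Λ (f ∘ suc) i
  × fold i (f zero) (suc k) ≡ word Λ (f ∘ suc) v i
  × (∀ (a : Fin k) q → fold i (f zero) (suc (toℕ a)) ≢ word Λ (f ∘ suc) q i)

word-natural : ∀ {ℓ X Y} (Λ : Lat ℓ) {φ : X → Y} {f g} → Natural φ f g →
               ∀ q x → φ (word Λ f q x) ≡ word Λ g q (φ x)
word-natural pt              nat q       x = refl
word-natural (ext Λ k v) {φ} {f} {g} nat (a , q) x =
  trans (fold-natural φ (nat zero) (toℕ a) _)
        (cong (λ y → fold y (g zero) (toℕ a)) (word-natural Λ {φ} (nat ∘ suc) q x))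

-- Commuting with a map is naturality with respect to it, so `word-natural` applies twice.
word-comm : ∀ {ℓ X} (Λ : Lat ℓ) {f : Gens ℓ X} → Commute f →
            ∀ p q x → word Λ f p (word Λ f q x) ≡ word Λ f q (word Λ f p x)
word-comm Λ {f} com p q = word-natural Λ {word Λ f p}
  (λ j x → sym (word-natural Λ {f j} (com j) p x)) q

word-inj : ∀ {ℓ X} (Λ : Lat ℓ) {f : Gens ℓ X} → (∀ j → Inj (f j)) → ∀ q → Inj (word Λ f q)
word-inj pt          inj q       eq = eq
word-inj (ext Λ k v) inj (a , q) eq =
  word-inj Λ (inj ∘ suc) q (fold-inj (inj zero) (toℕ a) eq)

word-surj : ∀ {ℓ X} (Λ : Lat ℓ) {f : Gens ℓ X} → (∀ j → Surj (f j)) → ∀ q → Surj (word Λ f q)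
word-surj pt          sur q       y = y , refl
word-surj (ext Λ k v) {f} sur (a , q) y with fold-surj (sur zero) (toℕ a) y
... | z , eq with word-surj Λ (sur ∘ suc) q z
... | x , eq′ = x , trans (cong (λ u → fold u (f zero) (toℕ a)) eq′) eq

word-origin : ∀ {ℓ X} (Λ : Lat ℓ) (f : Gens ℓ X) x → word Λ f (origin Λ) x ≡ x
word-origin pt          f x = refl
word-origin (ext Λ k v) f x = word-origin Λ (f ∘ suc) x

gen-comm : ∀ {ℓ} (Λ : Lat ℓ) → Commute (gen Λ)
gen-comm (ext Λ k v) (suc i) (suc j) (a , q) = cong (a ,_) (gen-comm Λ i j q)
gen-comm (ext Λ k v) zero    zero    x       = refl
gen-comm (ext Λ k v) zero    (suc j) (a , q) with view a
... | ‵fromℕ     = cong (zero ,_) (sym (word-natural Λ {gen Λ j} (gen-comm Λ j) v q))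
... | ‵inject₁ b = refl
gen-comm (ext Λ k v) (suc i) zero    (a , q) with view a
... | ‵fromℕ     = cong (zero ,_) (word-natural Λ {gen Λ i} (gen-comm Λ i) v q)
... | ‵inject₁ b = refl

gen-inj : ∀ {ℓ} (Λ : Lat ℓ) j → Inj (gen Λ j)
gen-inj (ext Λ k v) (suc j) {a , q} {b , p} eq =
  cong₂ _,_ (cong proj₁ eq) (gen-inj Λ j (cong proj₂ eq))
gen-inj (ext Λ k v) zero {a , q} {b , p} eq with view a | view b
... | ‵fromℕ      | ‵fromℕ      = cong (_ ,_) (word-inj Λ (gen-inj Λ) v (cong proj₂ eq))
... | ‵inject₁ a′ | ‵inject₁ b′ =
  cong₂ _,_ (cong inject₁ (Finₚ.suc-injective (cong proj₁ eq))) (cong proj₂ eq)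

gen-top : ∀ {ℓ} (Λ : Lat ℓ) k v q →
          gen (ext Λ k v) zero (fromℕ k , q) ≡ (zero , word Λ (gen Λ) v q)
gen-top Λ k v q rewrite view-fromℕ k = refl

gen-step : ∀ {ℓ} (Λ : Lat ℓ) k v (b : Fin k) q →
           gen (ext Λ k v) zero (inject₁ b , q) ≡ (suc b , q)
gen-step Λ k v b q rewrite view-inject₁ b = refl

gen-surj : ∀ {ℓ} (Λ : Lat ℓ) j → Surj (gen Λ j)
gen-surj (ext Λ k v) (suc j) (a , q) with gen-surj Λ j q
... | p , eq = (a , p) , cong (a ,_) eq
gen-surj (ext Λ k v) zero (zero , q) with word-surj Λ (gen-surj Λ) v q
... | p , eq = (fromℕ k , p) , trans (gen-top Λ k v p) (cong (zero ,_) eq)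
gen-surj (ext Λ k v) zero (suc b , q) = (inject₁ b , q) , gen-step Λ k v b q

gen-fold : ∀ {ℓ} (Λ : Lat ℓ) k v q (a : Fin (suc k)) →
           fold (zero , q) (gen (ext Λ k v) zero) (toℕ a) ≡ (a , q)
gen-fold Λ k v q a = go (toℕ a) a refl
  where
  go : ∀ m (a : Fin (suc k)) → toℕ a ≡ m → fold (zero , q) (gen (ext Λ k v) zero) m ≡ (a , q)
  go zero    zero    _  = refl
  go (suc m) (suc b) eq = trans
    (cong (gen (ext Λ k v) zero)
      (go m (inject₁ b) (trans (Finₚ.toℕ-inject₁ b) (ℕₚ.suc-injective eq))))
    (gen-step Λ k v b q)

-- Translations are transitive on the quotient, and each coset is reached from the origin by its own
-- representative.
gen-origin : ∀ {ℓ} (Λ : Lat ℓ) q → word Λ (gen Λ) q (origin Λ) ≡ q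
gen-origin pt          q       = refl
gen-origin (ext Λ k v) (a , q) = trans
  (cong (λ y → fold y (gen (ext Λ k v) zero) (toℕ a))
    (trans (sym (word-natural Λ {zero ,_} {gen Λ} (λ j x → refl) q (origin Λ)))
           (cong (zero ,_) (gen-origin Λ q))))
  (gen-fold Λ k v q a)

-- Stabilisers: transport, uniqueness and existence

fits-transport : ∀ {ℓ X Y} (Λ : Lat ℓ) {φ : X → Y} {f g} → Inj φ → Natural φ f g →
                 ∀ {i} → Fits Λ f i → Fits Λ g (φ i)
fits-transport pt inj nat fit = tt
fits-transport (ext Λ k v) {φ} {g = g} inj nat {i} (fit , eq , min) =
    fits-transport Λ inj (nat ∘ suc) fit
  , trans (sym (fold-natural φ {r = g zero} (nat zero) (suc k) i))
          (trans (cong φ eq) (word-natural Λ {φ} (nat ∘ suc) v i))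
  , λ a q eq′ → min a q (inj (trans (fold-natural φ {r = g zero} (nat zero) (suc (toℕ a)) i)
                   (trans eq′ (sym (word-natural Λ {φ} (nat ∘ suc) q i)))))

-- Every normal form occurs as a stabiliser; transported along an embedding, this gives the
-- stabiliser in the tuples assembled below.
gen-fits : ∀ {ℓ} (Λ : Lat ℓ) → Fits Λ (gen Λ) (origin Λ)
gen-fits pt          = tt
gen-fits (ext Λ k v) =
    fits-transport Λ {φ} (cong proj₂) (λ j x → refl) (gen-fits Λ)
  , trans (cong σ (trans (cong (fold o σ) (sym (Finₚ.toℕ-fromℕ k)))
                         (gen-fold Λ k v (origin Λ) (fromℕ k))))
          (trans (gen-top Λ k v (origin Λ)) (word-nat v))
  -- Minimality: the left side has newest exponent `suc a`, while words in the older generators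
  -- leave that exponent zero.
  , λ a q eq → case trans (sym (gen-fold Λ k v (origin Λ) (suc a)))
                          (trans eq (sym (word-nat q))) of λ ()
  where
  φ = λ (q : Q Λ) → (Fin.zero {k} , q)
  σ = gen (ext Λ k v) zero
  o = origin (ext Λ k v)
  word-nat : ∀ q → (zero , word Λ (gen Λ) q (origin Λ)) ≡ word Λ (gen (ext Λ k v) ∘ suc) q o
  word-nat q = word-natural Λ {φ} {gen Λ} (λ j x → refl) q (origin Λ)

-- The orbit map q ↦ q·i intertwines the translations of ℤ^ℓ / Λ with f.
fits-natural : ∀ {ℓ X} (Λ : Lat ℓ) {f : Gens ℓ X} → Commute f → ∀ {i} → Fits Λ f i →
               Natural (λ q → word Λ f q i) (gen Λ) f
fits-natural (ext Λ k v) {f} com {i} (fit , eq , min) (suc j) (a , q) = trans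
  (cong (λ y → fold y (f zero) (toℕ a))
    (fits-natural Λ (λ j k → com (suc j) (suc k)) fit j q))
  (sym (fold-natural (f (suc j)) (com (suc j) zero) (toℕ a) _))
fits-natural (ext Λ k v) {f} com {i} (fit , eq , min) zero (a , q) with view a
... | ‵inject₁ b = cong (λ m → f zero (fold _ (f zero) m)) (sym (Finₚ.toℕ-inject₁ b))
... | ‵fromℕ     = begin
  word Λ f′ (word Λ (gen Λ) v q) i
    ≡⟨ word-natural Λ {λ q → word Λ f′ q i} (fits-natural Λ com′ fit) v q ⟩
  word Λ f′ v (word Λ f′ q i)
    ≡⟨ word-comm Λ com′ v q i ⟩
  word Λ f′ q (word Λ f′ v i)
    ≡⟨ cong (word Λ f′ q) eq ⟨
  word Λ f′ q (fold i (f zero) (suc k))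
    ≡⟨ fold-natural (word Λ f′ q) {r = f zero} (λ x → sym (word-natural Λ {f zero} (λ j → com zero (suc j)) q x)) (suc k) i ⟩
  f zero (fold (word Λ f′ q i) (f zero) k)
    ≡⟨ cong (λ m → f zero (fold (word Λ f′ q i) (f zero) m)) (Finₚ.toℕ-fromℕ k) ⟨
  f zero (fold (word Λ f′ q i) (f zero) (toℕ (fromℕ k))) ∎
  where
  open ≡-Reasoning
  f′ = f ∘ suc
  com′ : Commute f′
  com′ j k = com (suc j) (suc k)

-- Orbit-stabiliser: distinct cosets reach distinct points. Equal newest exponents cancel, unequal
-- ones contradict minimality of `k`.
fits-inj : ∀ {ℓ X} (Λ : Lat ℓ) {f : Gens ℓ X} → Commute f → (∀ j → Inj (f j)) →
           ∀ {i} → Fits Λ f i → Inj (λ q → word Λ f q i)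
fits-inj pt com inj fit eq = refl
fits-inj (ext Λ k v) {f} com inj {i} (fit , eq , min) {a , q} {b , p} e =
  case ℕₚ.<-cmp (toℕ a) (toℕ b) of λ where
    (tri≈ _ a≡b _) → cong₂ _,_ (Finₚ.toℕ-injective a≡b)
      (fits-inj Λ com′ (inj ∘ suc) fit (fold-inj (inj zero) (toℕ a)
        (trans e (cong (fold _ (f zero)) (sym a≡b)))))
    (tri< a<b _ _) → contradiction (sym e) (distinct b a p q a<b)
    (tri> _ _ b<a) → contradiction e (distinct a b q p b<a)
  where
  f′ = f ∘ suc
  com′ : Commute f′
  com′ j k = com (suc j) (suc k)
  -- Cancelling powers of the newest generator σ and then the word q would put
  -- σ^(a-b) i into the orbit under the older generators.
  distinct : ∀ (a b : Fin (suc k)) q p → toℕ b ℕ.< toℕ a →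
             fold (word Λ f′ q i) (f zero) (toℕ a) ≢ fold (word Λ f′ p i) (f zero) (toℕ b)
  distinct a b q p b<a e with ℕₚ.m≤n⇒∃[o]m+o≡n b<a | word-surj Λ (gen-surj Λ) q p
  ... | c , sb+c≡a | r , wr≡p = min c′ r (trans (cong (λ m → fold i (f zero) (suc m)) toℕ-c′) hit)
    where
    c+sb≡a : toℕ b ℕ.+ suc c ≡ toℕ a
    c+sb≡a = trans (ℕₚ.+-suc (toℕ b) c) sb+c≡a
    c<k : c ℕ.< k
    c<k = ℕₚ.≤-trans (ℕₚ.m≤n+m (suc c) (toℕ b))
            (ℕₚ.≤-trans (ℕₚ.≤-reflexive c+sb≡a) (ℕₚ.<⇒≤pred (Finₚ.toℕ<n a)))
    c′ = Fin.fromℕ< c<k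
    toℕ-c′ : toℕ c′ ≡ c
    toℕ-c′ = Finₚ.toℕ-fromℕ< c<k
    cancelled : fold (word Λ f′ q i) (f zero) (suc c) ≡ word Λ f′ p i
    cancelled = fold-inj (inj zero) (toℕ b)
      (trans (sym (fold-+ _ (f zero) (toℕ b))) (trans (cong (fold _ (f zero)) c+sb≡a) e))
    hit : fold i (f zero) (suc c) ≡ word Λ f′ r i
    hit = word-inj Λ (inj ∘ suc) q (begin
      word Λ f′ q (fold i (f zero) (suc c))
        ≡⟨ fold-natural (word Λ f′ q) {r = f zero} (λ x → sym (word-natural Λ {f zero} (λ j → com zero (suc j)) q x)) (suc c) i ⟩
      fold (word Λ f′ q i) (f zero) (suc c)  ≡⟨ cancelled ⟩
      word Λ f′ p i                          ≡⟨ cong (λ p → word Λ f′ p i) wr≡p ⟨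
      word Λ f′ (word Λ (gen Λ) q r) i
        ≡⟨ word-natural Λ {λ q → word Λ f′ q i} (fits-natural Λ com′ fit) q r ⟩
      word Λ f′ q (word Λ f′ r i)            ∎)
      where open ≡-Reasoning

-- The normal form is forced one generator at a time: the older part by induction, then `k` as a
-- least exponent, then `v` by `fits-inj`.
fits-unique : ∀ {ℓ X} (Λ Λ′ : Lat ℓ) {f : Gens ℓ X} → Commute f → (∀ j → Inj (f j)) →
              ∀ {i} → Fits Λ f i → Fits Λ′ f i → Λ ≡ Λ′
fits-unique pt pt _ _ _ _ = refl
fits-unique (ext Λ k v) (ext Λ′ k′ v′) {f} com inj {i} (fit , eq , min) (fit′ , eq′ , min′)
  with fits-unique Λ Λ′ (λ j k → com (suc j) (suc k)) (inj ∘ suc) fit fit′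
... | refl with ℕₚ.<-cmp k k′
... | tri≈ _ refl _ = cong (ext Λ k)
  (fits-inj Λ (λ j k → com (suc j) (suc k)) (inj ∘ suc) fit (trans (sym eq) eq′))
... | tri< k<k′ _ _ = contradiction
  (trans (cong (λ m → fold i (f zero) (suc m)) (Finₚ.toℕ-fromℕ< k<k′)) eq)
  (min′ (Fin.fromℕ< k<k′) v)
... | tri> _ _ k′<k = contradiction
  (trans (cong (λ m → fold i (f zero) (suc m)) (Finₚ.toℕ-fromℕ< k′<k)) eq′)
  (min (Fin.fromℕ< k′<k) v′)

anyQ? : ∀ {ℓ} (Λ : Lat ℓ) {P : Q Λ → Set} → (∀ q → Dec (P q)) → Dec (∃ P)
anyQ? pt          P? = map′ (tt ,_) proj₂ (P? tt)
anyQ? (ext Λ k v) P? = map′ (λ (a , q , p) → (a , q) , p) (λ ((a , q) , p) → a , q , p)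
  (Finₚ.any? (λ a → anyQ? Λ (λ q → P? (a , q))))

-- This bound on the exponents is what puts a stabiliser occurring on `n` points into the finite
-- list `lats`.
data Heights (n : ℕ) : ∀ {ℓ} → Lat ℓ → Set where
  pt  : Heights n pt
  ext : ∀ {ℓ} {Λ : Lat ℓ} {k v} → k ℕ.< n → Heights n Λ → Heights n (ext Λ k v)

-- Two of the n + 1 points i, σ i, ..., σ^n i coincide, and injectivity cancels the common power.
returns : ∀ {n} (σ : Fin n → Fin n) → Inj σ → ∀ i → ∃ λ (k : Fin n) → fold i σ (suc (toℕ k)) ≡ i
returns {n} σ inj i with Finₚ.pigeonhole (ℕₚ.n<1+n n) (λ (m : Fin (suc n)) → fold i σ (toℕ m))
... | a , b , a<b , eq with ℕₚ.m≤n⇒∃[o]m+o≡n a<b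
... | c , sa+c≡b = Fin.fromℕ< c<n , trans (cong (λ m → fold i σ (suc m)) (Finₚ.toℕ-fromℕ< c<n))
    (fold-inj inj (toℕ a) (trans (sym (fold-+ i σ (toℕ a))) (trans (cong (fold i σ) a+sc≡b) (sym eq))))
  where
  a+sc≡b : toℕ a ℕ.+ suc c ≡ toℕ b
  a+sc≡b = trans (ℕₚ.+-suc (toℕ a) c) sa+c≡b
  c<n : c ℕ.< n
  c<n = ℕₚ.≤-trans (ℕₚ.m≤n+m (suc c) (toℕ a))
          (ℕₚ.≤-trans (ℕₚ.≤-reflexive a+sc≡b) (ℕₚ.<⇒≤pred (Finₚ.toℕ<n b)))

fits-exists : ∀ {n ℓ} (f : Gens ℓ (Fin n)) → (∀ j → Inj (f j)) → ∀ i →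
              ∃ λ (Λ : Lat ℓ) → Heights n Λ × Fits Λ f i
fits-exists {ℓ = zero}  f inj i = pt , pt , tt
fits-exists {n} {suc ℓ} f inj i with fits-exists (f ∘ suc) (inj ∘ suc) i
... | Λ , hts , fit
  -- The new height comes from the least power that brings `i` back into the orbit of the older
  -- generators. Searching for the first failure of `¬ Hit` is what produces the double negation
  -- removed below.
  with Finₚ.¬∀⟶∃¬-smallest n (λ k → ¬ Hit k) (λ k → ¬? (hit? k)) (λ none → uncurry none first)
  where
  Hit : Fin n → Set
  Hit k = ∃ λ q → fold i (f zero) (suc (toℕ k)) ≡ word Λ (f ∘ suc) q i
  hit? : ∀ k → Dec (Hit k)
  hit? k = anyQ? Λ (λ q → fold i (f zero) (suc (toℕ k)) ≟ word Λ (f ∘ suc) q i)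
  first : ∃ Hit
  first with returns (f zero) (inj zero) i
  ... | k , eq = k , origin Λ , trans eq (sym (word-origin Λ (f ∘ suc) i))
... | k , ¬¬hit , least
  with decidable-stable (anyQ? Λ (λ q → fold i (f zero) (suc (toℕ k)) ≟ word Λ (f ∘ suc) q i)) ¬¬hit
... | v , eq = ext Λ (toℕ k) v , ext (Finₚ.toℕ<n k) hts , fit , eq , λ a q e →
  least a (q , trans (cong (λ m → fold i (f zero) (suc m)) (Finₚ.toℕ-inject a)) e)

-- Counting with duplicate-free lists

length-≡-of-same-members : {A : Set} {xs ys : List A} → Unique xs → Unique ys →
                           (∀ {x} → x ∈ xs → x ∈ ys) → (∀ {x} → x ∈ ys → x ∈ xs) →
                           length xs ≡ length ys
length-≡-of-same-members xs! ys! to from =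
  ↭-length (∼bag⇒↭ (unique∧set⇒bag xs! ys! (mk⇔ to from)))

module _ {A B : Set} {f : A → List B} where

  concatMap-unique : {xs : List A} → Unique xs → (∀ x → Unique (f x)) →
                     (∀ {x y z} → z ∈ f x → z ∈ f y → x ≡ y) → Unique (concatMap f xs)
  concatMap-unique []            f! disj = []
  concatMap-unique {x ∷ xs} (x∉xs ∷ xs!) f! disj = Uniqueₚ.++⁺ (f! x) (concatMap-unique xs! f! disj)
    λ (z∈fx , z∈rest) → case find (∈-concatMap⁻ f {xs = xs} z∈rest) of λ where
      (y , y∈xs , z∈fy) → All.lookup x∉xs y∈xs (disj z∈fx z∈fy)

  ∈-concatMap : ∀ {xs x z} → x ∈ xs → z ∈ f x → z ∈ concatMap f xs
  ∈-concatMap x∈xs z∈fx = ∈-concatMap⁺ f (lose x∈xs z∈fx)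

  length-concatMap : ∀ xs → length (concatMap f xs) ≡ sumℕ (map (length ∘ f) xs)
  length-concatMap []       = refl
  length-concatMap (x ∷ xs) = trans (Listₚ.length-++ (f x)) (cong (length (f x) ℕ.+_) (length-concatMap xs))

length-cartesianProduct : {A B : Set} (xs : List A) (ys : List B) →
                          length (cartesianProduct xs ys) ≡ length xs ℕ.* length ys
length-cartesianProduct []       ys = refl
length-cartesianProduct (x ∷ xs) ys = trans (Listₚ.length-++ (map (x ,_) ys))
  (cong₂ ℕ._+_ (Listₚ.length-map (x ,_) ys) (length-cartesianProduct xs ys))

lookup-ext : {A : Set} {n : ℕ} {u v : Vec A n} → (∀ i → lookup u i ≡ lookup v i) → u ≡ v
lookup-ext {u = u} {v} eq =
  trans (sym (Vecₚ.tabulate∘lookup u)) (trans (Vecₚ.tabulate-cong eq) (Vecₚ.tabulate∘lookup v))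

-- Commuting tuples as actions of ℤ^ℓ

vecsOver-unique : {A : Set} {xs : List A} → Unique xs → ∀ ℓ → Unique (vecsOver xs ℓ)
vecsOver-unique xs! zero    = [] ∷ []
vecsOver-unique {xs = xs} xs! (suc ℓ) = concatMap-unique xs!
  (λ x → Uniqueₚ.map⁺ Vecₚ.∷-injectiveʳ (vecsOver-unique xs! ℓ)) disj
  where
  disj : ∀ {x y z} → z ∈ map (x ∷_) (vecsOver xs ℓ) → z ∈ map (y ∷_) (vecsOver xs ℓ) → x ≡ y
  disj z∈₁ z∈₂ with ∈-map⁻ _ z∈₁ | ∈-map⁻ _ z∈₂
  ... | _ , _ , refl | _ , _ , eq = Vecₚ.∷-injectiveˡ eq

∈-vecsOver⁺ : {A : Set} {xs : List A} {ℓ : ℕ} (t : Vec A ℓ) →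
              (∀ j → lookup t j ∈ xs) → t ∈ vecsOver xs ℓ
∈-vecsOver⁺ []      t∈ = here refl
∈-vecsOver⁺ (x ∷ t) t∈ = ∈-concatMap (t∈ zero) (∈-map⁺ _ (∈-vecsOver⁺ t (t∈ ∘ suc)))

∈-vecsOver⁻ : {A : Set} {xs : List A} {ℓ : ℕ} {t : Vec A ℓ} →
              t ∈ vecsOver xs ℓ → ∀ j → lookup t j ∈ xs
∈-vecsOver⁻ {xs = xs} {suc ℓ} t∈ j
  with find (∈-concatMap⁻ (λ x → map (x ∷_) (vecsOver xs ℓ)) {xs = xs} t∈)
... | x , x∈xs , t∈x with ∈-map⁻ _ t∈x
∈-vecsOver⁻ t∈ zero    | x , x∈xs , t∈x | u , u∈ , refl = x∈xs
∈-vecsOver⁻ t∈ (suc j) | x , x∈xs , t∈x | u , u∈ , refl = ∈-vecsOver⁻ u∈ j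

unique⇒lookup-inj : {A : Set} {n : ℕ} (v : Vec A n) → Unique (toList v) → Inj (lookup v)
unique⇒lookup-inj (x ∷ v) (x∉v ∷ v!) {zero}  {zero}  eq = refl
unique⇒lookup-inj (x ∷ v) (x∉v ∷ v!) {zero}  {suc j} eq =
  contradiction eq (VecAllₚ.lookup⁺ (VecAllₚ.toList⁻ x∉v) j)
unique⇒lookup-inj (x ∷ v) (x∉v ∷ v!) {suc i} {zero}  eq =
  contradiction (sym eq) (VecAllₚ.lookup⁺ (VecAllₚ.toList⁻ x∉v) i)
unique⇒lookup-inj (x ∷ v) (x∉v ∷ v!) {suc i} {suc j} eq = cong suc (unique⇒lookup-inj v v! eq)

lookup-inj⇒unique : {A : Set} {n : ℕ} (v : Vec A n) → Inj (lookup v) → Unique (toList v)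
lookup-inj⇒unique []      inj = []
lookup-inj⇒unique (x ∷ v) inj =
  VecAllₚ.toList⁺ (VecAllₚ.lookup⁻ (λ i eq → case inj {zero} {suc i} eq of λ ()))
  ∷ lookup-inj⇒unique v (Finₚ.suc-injective ∘ inj)

∈-Sym⁺ : ∀ {n} (π : Perm n) → Inj (lookup π) → π ∈ Sym n
∈-Sym⁺ π inj = ∈-filter⁺ _ (∈-vecsOver⁺ π (λ j → ∈-allFin _)) (lookup-inj⇒unique π inj)

∈-Sym⁻ : ∀ {n} {π : Perm n} → π ∈ Sym n → Inj (lookup π)
∈-Sym⁻ {n} {π} π∈ = unique⇒lookup-inj π (proj₂ (∈-filter⁻ _ {xs = vecsOver (allFin n) n} π∈))

act : ∀ {ℓ n} → Vec (Perm n) ℓ → Gens ℓ (Fin n)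
act t j = lookup (lookup t j)

table : ∀ {ℓ n} → Gens ℓ (Fin n) → Vec (Perm n) ℓ
table f = tabulate (λ j → tabulate (f j))

act-table : ∀ {ℓ n} (f : Gens ℓ (Fin n)) j x → act (table f) j x ≡ f j x
act-table f j x = trans (cong (λ π → lookup π x) (Vecₚ.lookup∘tabulate _ j)) (Vecₚ.lookup∘tabulate (f j) x)

act-ext : ∀ {ℓ n} {t u : Vec (Perm n) ℓ} → (∀ j x → act t j x ≡ act u j x) → t ≡ u
act-ext eq = lookup-ext (λ j → lookup-ext (eq j))

∈-C⁺ : ∀ {ℓ n} (t : Vec (Perm n) ℓ) → Commute (act t) → (∀ j → Inj (act t j)) → t ∈ C ℓ n
∈-C⁺ t com inj = ∈-filter⁺ commuting? (∈-vecsOver⁺ t (λ j → ∈-Sym⁺ (lookup t j) (inj j)))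
  (All.tabulate λ {j} _ → All.tabulate λ {k} _ → Vecₚ.tabulate-cong (com j k))

∈-C⁻ : ∀ {ℓ n} {t : Vec (Perm n) ℓ} → t ∈ C ℓ n → Commute (act t) × (∀ j → Inj (act t j))
∈-C⁻ {ℓ} {n} {t} t∈ with ∈-filter⁻ commuting? {xs = vecsOver (Sym n) ℓ} t∈
... | t∈′ , com = (λ j k x → trans (sym (Vecₚ.lookup∘tabulate _ x))
        (trans (cong (λ π → lookup π x) (All.lookup (All.lookup com (∈-allFin j)) (∈-allFin k)))
               (Vecₚ.lookup∘tabulate _ x)))
    , λ j → ∈-Sym⁻ (∈-vecsOver⁻ t∈′ j)

C-unique : ∀ ℓ n → Unique (C ℓ n)
C-unique ℓ n = Uniqueₚ.filter⁺ commuting? (vecsOver-unique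
  (Uniqueₚ.filter⁺ _ (vecsOver-unique (Uniqueₚ.allFin⁺ n) n)) ℓ)

-- Ordered arrangements of d out of d + m points

-- The first entry is the image of the first point, the others arrange the
-- remaining points in the complement of that image.
Arr : ℕ → ℕ → Set
Arr zero    m = ⊤
Arr (suc d) m = Fin (suc (d ℕ.+ m)) × Arr d m

glue : ∀ {d m} → Arr d m → Fin d ⊎ Fin m → Fin (d ℕ.+ m)
glue {zero}  c       (inj₂ r)       = r
glue {suc d} (x , c) (inj₁ zero)    = x
glue {suc d} (x , c) (inj₁ (suc i)) = punchIn x (glue c (inj₁ i))
glue {suc d} (x , c) (inj₂ r)       = punchIn x (glue c (inj₂ r))

glue-inj : ∀ {d m} (c : Arr d m) → Inj (glue c)
glue-inj {zero}  c {inj₂ r} {inj₂ s} eq = cong inj₂ eq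
glue-inj {suc d} (x , c) {inj₁ zero}    {inj₁ zero}    eq = refl
glue-inj {suc d} (x , c) {inj₁ zero}    {inj₁ (suc j)} eq = contradiction (sym eq) (Finₚ.punchInᵢ≢i x _)
glue-inj {suc d} (x , c) {inj₁ zero}    {inj₂ s}       eq = contradiction (sym eq) (Finₚ.punchInᵢ≢i x _)
glue-inj {suc d} (x , c) {inj₁ (suc i)} {inj₁ zero}    eq = contradiction eq (Finₚ.punchInᵢ≢i x _)
glue-inj {suc d} (x , c) {inj₂ r}       {inj₁ zero}    eq = contradiction eq (Finₚ.punchInᵢ≢i x _)
glue-inj {suc d} (x , c) {inj₁ (suc i)} {inj₁ (suc j)} eq =
  cong (Sum.map₁ suc) (glue-inj c {inj₁ i} {inj₁ j} (Finₚ.punchIn-injective x _ _ eq))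
glue-inj {suc d} (x , c) {inj₁ (suc i)} {inj₂ s}       eq =
  cong (Sum.map₁ suc) (glue-inj c {inj₁ i} {inj₂ s} (Finₚ.punchIn-injective x _ _ eq))
glue-inj {suc d} (x , c) {inj₂ r}       {inj₁ (suc j)} eq =
  cong (Sum.map₁ suc) (glue-inj c {inj₂ r} {inj₁ j} (Finₚ.punchIn-injective x _ _ eq))
glue-inj {suc d} (x , c) {inj₂ r}       {inj₂ s}       eq =
  cong (Sum.map₁ suc) (glue-inj c {inj₂ r} {inj₂ s} (Finₚ.punchIn-injective x _ _ eq))

glue-surj : ∀ {d m} (c : Arr d m) → Surj (glue c)
glue-surj {zero}  c       y = inj₂ y , refl
glue-surj {suc d} (x , c) y with x ≟ y
... | yes x≡y = inj₁ zero , x≡y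
... | no  x≢y with glue-surj c (punchOut x≢y)
...   | inj₁ i , eq = inj₁ (suc i) , trans (cong (punchIn x) eq) (Finₚ.punchIn-punchOut x≢y)
...   | inj₂ r , eq = inj₂ r       , trans (cong (punchIn x) eq) (Finₚ.punchIn-punchOut x≢y)

arr-unique : ∀ {d m} (c c′ : Arr d m) → (∀ i → glue c (inj₁ i) ≡ glue c′ (inj₁ i)) → c ≡ c′
arr-unique {zero}  c       c′        eq = refl
arr-unique {suc d} (x , c) (x′ , c′) eq with eq zero
... | refl = cong (x ,_) (arr-unique c c′ (λ i → Finₚ.punchIn-injective x _ _ (eq (suc i))))

arr-exists : ∀ {d m} (φ : Fin d → Fin (d ℕ.+ m)) → Inj φ →
             ∃ λ (c : Arr d m) → ∀ i → glue c (inj₁ i) ≡ φ i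
arr-exists {zero}      φ inj = tt , λ ()
arr-exists {suc d} {m} φ inj = (φ zero , proj₁ rest) , λ where
    zero    → refl
    (suc i) → trans (cong (punchIn (φ zero)) (proj₂ rest i)) (Finₚ.punchIn-punchOut (φ₀≢φₛ i))
  where
  φ₀≢φₛ : ∀ i → φ zero ≢ φ (suc i)
  φ₀≢φₛ i eq = case inj eq of λ ()
  rest : ∃ λ (c : Arr d m) → ∀ i → glue c (inj₁ i) ≡ punchOut (φ₀≢φₛ i)
  rest = arr-exists (λ i → punchOut (φ₀≢φₛ i))
    (λ eq → Finₚ.suc-injective (inj (Finₚ.punchOut-injective (φ₀≢φₛ _) (φ₀≢φₛ _) eq)))

arrs : ∀ d m → List (Arr d m)
arrs zero    m = tt ∷ []
arrs (suc d) m = cartesianProduct (allFin _) (arrs d m)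

arrs-unique : ∀ d m → Unique (arrs d m)
arrs-unique zero    m = [] ∷ []
arrs-unique (suc d) m = Uniqueₚ.cartesianProduct⁺ (Uniqueₚ.allFin⁺ _) (arrs-unique d m)

∈-arrs : ∀ {d m} (c : Arr d m) → c ∈ arrs d m
∈-arrs {zero}  tt      = here refl
∈-arrs {suc d} (x , c) = ∈-cartesianProduct⁺ (∈-allFin x) (∈-arrs c)

-- fall d m = (d + m)! / m!
fall : ℕ → ℕ → ℕ
fall zero    m = 1
fall (suc d) m = suc (d ℕ.+ m) ℕ.* fall d m

length-arrs : ∀ d m → length (arrs d m) ≡ fall d m
length-arrs zero    m = refl
length-arrs (suc d) m = trans (length-cartesianProduct (allFin _) (arrs d m))
  (cong₂ ℕ._*_ (Listₚ.length-tabulate {n = suc (d ℕ.+ m)} id) (length-arrs d m))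

-- Actions with a marked point of given stabiliser

size : ∀ {ℓ} → Lat ℓ → ℕ
size pt          = 1
size (ext Λ k _) = suc k ℕ.* size Λ

index : ∀ {ℓ} (Λ : Lat ℓ) → Q Λ → Fin (size Λ)
index pt          q       = zero
index (ext Λ k v) (a , q) = combine a (index Λ q)

index-inj : ∀ {ℓ} (Λ : Lat ℓ) → Inj (index Λ)
index-inj pt          eq = refl
index-inj (ext Λ k v) {a , q} {b , p} eq with Finₚ.combine-injective a (index Λ q) b (index Λ p) eq
... | a≡b , eq′ = cong₂ _,_ a≡b (index-inj Λ eq′)

index-surj : ∀ {ℓ} (Λ : Lat ℓ) → Surj (index Λ)
index-surj pt          zero = tt , refl
index-surj (ext Λ k v) y with Finₚ.combine-surjective {suc k} y
... | a , i , eq with index-surj Λ i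
... | q , refl = (a , q) , eq

module Structures {ℓ} (Λ : Lat ℓ) (m : ℕ) where

  n = size Λ ℕ.+ m

  place : Arr (size Λ) m → Q Λ ⊎ Fin m → Fin n
  place c = glue c ∘ Sum.map₁ (index Λ)

  place-inj : ∀ c → Inj (place c)
  place-inj c {inj₁ q} {inj₁ p} eq = cong inj₁ (index-inj Λ (inj₁-injective (glue-inj c eq)))
  place-inj c {inj₁ q} {inj₂ s} eq = case glue-inj c {inj₁ _} {inj₂ s} eq of λ ()
  place-inj c {inj₂ r} {inj₁ p} eq = case glue-inj c {inj₂ r} {inj₁ _} eq of λ ()
  place-inj c {inj₂ r} {inj₂ s} eq = cong inj₂ (inj₂-injective (glue-inj c {inj₂ r} {inj₂ s} eq))

  place-surj : ∀ c → Surj (place c)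
  place-surj c y with glue-surj c y
  ... | inj₂ r , eq = inj₂ r , eq
  ... | inj₁ i , eq with index-surj Λ i
  ...   | q , refl = inj₁ q , eq

  blocks : Gens ℓ (Fin m) → Gens ℓ (Q Λ ⊎ Fin m)
  blocks f j = Sum.map (gen Λ j) (f j)

  -- Translations act on the arranged points and `s` on the others. `c` alone fixes the numbering of
  -- the complement, so no pair is produced twice.
  assemble : Arr (size Λ) m × Vec (Perm m) ℓ → Vec (Perm n) ℓ × Fin n
  assemble (c , s) = table (λ j y → place c (blocks (act s) j (proj₁ (place-surj c y))))
                   , place c (inj₁ (origin Λ))

  assemble-natural : ∀ c s → Natural (place c) (blocks (act s)) (act (proj₁ (assemble (c , s))))
  assemble-natural c s j z = sym (trans (act-table _ j (place c z))
    (cong (place c ∘ blocks (act s) j) (place-inj c {proj₁ (place-surj c (place c z))} {z} (proj₂ (place-surj c (place c z))))))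

  assemble-orbit : ∀ c s q → word Λ (act (proj₁ (assemble (c , s)))) q (place c (inj₁ (origin Λ)))
                             ≡ place c (inj₁ q)
  assemble-orbit c s q = trans
    (sym (word-natural Λ {place c ∘ inj₁} {gen Λ} (λ j x → assemble-natural c s j (inj₁ x)) q (origin Λ)))
    (cong (place c ∘ inj₁) (gen-origin Λ q))

  -- The marked point `i` determines the arrangement, since coset `q` must lie at `word Λ f q i` for
  -- the assembled action `f`; then `s` is read off the complement.
  assemble-inj : Inj assemble
  assemble-inj {c , s} {c′ , s′} eq with arr-unique c c′ same
    where
    same : ∀ i → glue c (inj₁ i) ≡ glue c′ (inj₁ i)
    same i with index-surj Λ i
    ... | q , refl = trans (sym (assemble-orbit c s q))
      (trans (cong (λ (t , x) → word Λ (act t) q x) eq) (assemble-orbit c′ s′ q))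
  ... | refl = cong (c ,_) (act-ext λ j r → inj₂-injective (place-inj c {inj₂ _} {inj₂ _}
    (trans (assemble-natural c s j (inj₂ r))
      (trans (cong (λ (t , x) → act t j (place c (inj₂ r))) eq) (sym (assemble-natural c s′ j (inj₂ r)))))))

  assemble-∈C : ∀ c {s} → s ∈ C ℓ m → proj₁ (assemble (c , s)) ∈ C ℓ n
  assemble-∈C c {s} s∈ = ∈-C⁺ _ com inj
    where
    t = proj₁ (assemble (c , s))
    nat = assemble-natural c s
    s-com = proj₁ (∈-C⁻ s∈)
    s-inj = proj₂ (∈-C⁻ s∈)
    blocks-com : Commute (blocks (act s))
    blocks-com j k (inj₁ q) = cong inj₁ (gen-comm Λ j k q)
    blocks-com j k (inj₂ r) = cong inj₂ (s-com j k r)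
    blocks-inj : ∀ j → Inj (blocks (act s) j)
    blocks-inj j {inj₁ q} {inj₁ p} eq = cong inj₁ (gen-inj Λ j (inj₁-injective eq))
    blocks-inj j {inj₂ q} {inj₂ p} eq = cong inj₂ (s-inj j (inj₂-injective eq))
    twice : ∀ j k z → act t j (act t k (place c z)) ≡ place c (blocks (act s) j (blocks (act s) k z))
    twice j k z = trans (cong (act t j) (sym (nat k z))) (sym (nat j (blocks (act s) k z)))
    com : Commute (act t)
    com j k y with place-surj c y
    ... | z , refl = trans (twice j k z) (trans (cong (place c) (blocks-com j k z)) (sym (twice k j z)))
    inj : ∀ j → Inj (act t j)
    inj j {x} {y} eq with place-surj c x | place-surj c y
    ... | z , refl | w , refl =
      cong (place c) (blocks-inj j {z} {w} (place-inj c {blocks (act s) j z} {blocks (act s) j w} (trans (nat j z) (trans eq (sym (nat j w))))))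

  assemble-fits : ∀ c s → Fits Λ (act (proj₁ (assemble (c , s)))) (place c (inj₁ (origin Λ)))
  assemble-fits c s = fits-transport Λ {place c ∘ inj₁} (λ {q} {p} eq → inj₁-injective (place-inj c {inj₁ q} {inj₁ p} eq))
    (λ j x → assemble-natural c s j (inj₁ x)) (gen-fits Λ)

  -- The orbit map of `i` supplies the arrangement, and `s` is the restriction of `t` to the
  -- complement of the orbit.
  assemble-surj : ∀ {t i} → t ∈ C ℓ n → Fits Λ (act t) i →
                  ∃ λ c → ∃ λ s → s ∈ C ℓ m × assemble (c , s) ≡ (t , i)
  assemble-surj {t} {i} t∈ fit with arr-exists orbit orbit-inj
    where
    orbit : Fin (size Λ) → Fin n
    orbit x = word Λ (act t) (proj₁ (index-surj Λ x)) i
    orbit-inj : Inj orbit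
    orbit-inj {x} {y} eq = trans (sym (proj₂ (index-surj Λ x)))
      (trans (cong (index Λ) (fits-inj Λ (proj₁ (∈-C⁻ t∈)) (proj₂ (∈-C⁻ t∈)) fit eq))
             (proj₂ (index-surj Λ y)))
  ... | c , glue-c = c , s , s∈ , cong₂ _,_ (act-ext same) (trans (on-orbit (origin Λ)) (word-origin Λ (act t) i))
    where
    t-com = proj₁ (∈-C⁻ t∈)
    t-inj = proj₂ (∈-C⁻ t∈)
    on-orbit : ∀ q → place c (inj₁ q) ≡ word Λ (act t) q i
    on-orbit q = trans (glue-c (index Λ q))
      (cong (λ p → word Λ (act t) p i) (index-inj Λ (proj₂ (index-surj Λ (index Λ q)))))
    on-orbit-gen : ∀ j q → place c (inj₁ (gen Λ j q)) ≡ act t j (place c (inj₁ q))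
    on-orbit-gen j q = trans (on-orbit (gen Λ j q))
      (trans (fits-natural Λ t-com fit j q) (cong (act t j) (sym (on-orbit q))))
    -- The complement of the orbit is stable because gen Λ j is onto the orbit.
    off-orbit : ∀ j r → ∃ λ r′ → place c (inj₂ r′) ≡ act t j (place c (inj₂ r))
    off-orbit j r with place-surj c (act t j (place c (inj₂ r)))
    ... | inj₂ r′ , eq = r′ , eq
    ... | inj₁ q  , eq with gen-surj Λ j q
    ...   | p , refl = case place-inj c {inj₁ p} {inj₂ r} (t-inj j (trans (sym (on-orbit-gen j p)) eq)) of λ ()
    f : Gens ℓ (Fin m)
    f j r = proj₁ (off-orbit j r)
    s = table f
    s-natural : ∀ j r → place c (inj₂ (act s j r)) ≡ act t j (place c (inj₂ r))
    s-natural j r = trans (cong (place c ∘ inj₂) (act-table f j r)) (proj₂ (off-orbit j r))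
    twice : ∀ j k r → place c (inj₂ (act s j (act s k r))) ≡ act t j (act t k (place c (inj₂ r)))
    twice j k r = trans (s-natural j _) (cong (act t j) (s-natural k r))
    s∈ : s ∈ C ℓ m
    s∈ = ∈-C⁺ s
      (λ j k r → inj₂-injective (place-inj c {inj₂ _} {inj₂ _} (trans (twice j k r) (trans (t-com j k _) (sym (twice k j r))))))
      (λ j {x} {y} eq → inj₂-injective (place-inj c {inj₂ x} {inj₂ y} (t-inj j
        (trans (sym (s-natural j x)) (trans (cong (place c ∘ inj₂) eq) (s-natural j y))))))
    same : ∀ j y → act (proj₁ (assemble (c , s))) j y ≡ act t j y
    same j y with place-surj c y
    ... | inj₁ q , refl = trans (sym (assemble-natural c s j (inj₁ q))) (on-orbit-gen j q)
    ... | inj₂ r , refl = trans (sym (assemble-natural c s j (inj₂ r))) (s-natural j r)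

  structures : List (Vec (Perm n) ℓ × Fin n)
  structures = map assemble (cartesianProduct (arrs (size Λ) m) (C ℓ m))

  structures-unique : Unique structures
  structures-unique = Uniqueₚ.map⁺ assemble-inj
    (Uniqueₚ.cartesianProduct⁺ (arrs-unique (size Λ) m) (C-unique ℓ m))

  ∈-structures⁻ : ∀ {t i} → (t , i) ∈ structures → t ∈ C ℓ n × Fits Λ (act t) i
  ∈-structures⁻ ti∈ with ∈-map⁻ assemble ti∈
  ... | (c , s) , cs∈ , refl =
    assemble-∈C c (proj₂ (∈-cartesianProduct⁻ (arrs (size Λ) m) (C ℓ m) cs∈)) , assemble-fits c s

  ∈-structures⁺ : ∀ {t i} → t ∈ C ℓ n → Fits Λ (act t) i → (t , i) ∈ structures
  ∈-structures⁺ t∈ fit =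
    let c , s , s∈ , eq = assemble-surj t∈ fit
    in subst (_∈ structures) eq (∈-map⁺ assemble (∈-cartesianProduct⁺ (∈-arrs c) s∈))

  length-structures : length structures ≡ fall (size Λ) m ℕ.* length (C ℓ m)
  length-structures = trans (Listₚ.length-map assemble (cartesianProduct (arrs (size Λ) m) (C ℓ m)))
    (trans (length-cartesianProduct (arrs (size Λ) m) (C ℓ m))
           (cong (ℕ._* length (C ℓ m)) (length-arrs (size Λ) m)))

-- `Structures` lives on `size Λ ℕ.+ m` points, so its list is carried over to a given `n`. An index
-- above `n` leaves no room for the orbit.
pointed : ∀ {ℓ} n (Λ : Lat ℓ) → List (Vec (Perm n) ℓ × Fin n)
pointed {ℓ} n Λ with size Λ ℕ.≤? n
... | yes d≤n = subst (λ n → List (Vec (Perm n) ℓ × Fin n)) (ℕₚ.m+[n∸m]≡n d≤n)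
                      (Structures.structures Λ (n ∸ size Λ))
... | no  _   = []

pointedCount : ℕ → ℕ → ℕ → ℕ
pointedCount ℓ n d with d ℕ.≤? n
... | yes _ = fall d (n ∸ d) ℕ.* length (C ℓ (n ∸ d))
... | no  _ = 0

module _ {ℓ : ℕ} (Λ : Lat ℓ) where

  open Structures Λ using (structures)

  pointed-unique : ∀ n → Unique (pointed n Λ)
  pointed-unique n with size Λ ℕ.≤? n
  ... | no  _   = []
  ... | yes d≤n = go (ℕₚ.m+[n∸m]≡n d≤n)
    where
    -- With `n` generalised, the equation can be matched against `refl` and the transport
    -- disappears.
    go : ∀ {m n} (eq : size Λ ℕ.+ m ≡ n) → Unique (subst (λ n → List (Vec (Perm n) ℓ × Fin n)) eq (structures m))
    go refl = Structures.structures-unique Λ _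

  ∈-pointed⁻ : ∀ {n t i} → (t , i) ∈ pointed n Λ → t ∈ C ℓ n × Fits Λ (act t) i
  ∈-pointed⁻ {n} ti∈ with size Λ ℕ.≤? n
  ... | yes d≤n = go (ℕₚ.m+[n∸m]≡n d≤n) ti∈
    where
    go : ∀ {m n t i} (eq : size Λ ℕ.+ m ≡ n) →
         (t , i) ∈ subst (λ n → List (Vec (Perm n) ℓ × Fin n)) eq (structures m) → t ∈ C ℓ n × Fits Λ (act t) i
    go refl = Structures.∈-structures⁻ Λ _

  ∈-pointed⁺ : ∀ {n t i} → t ∈ C ℓ n → Fits Λ (act t) i → (t , i) ∈ pointed n Λ
  ∈-pointed⁺ {n} {t} {i} t∈ fit with size Λ ℕ.≤? n
  ... | yes d≤n = go (ℕₚ.m+[n∸m]≡n d≤n) t∈ fit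
    where
    go : ∀ {m n t i} (eq : size Λ ℕ.+ m ≡ n) → t ∈ C ℓ n → Fits Λ (act t) i →
         (t , i) ∈ subst (λ n → List (Vec (Perm n) ℓ × Fin n)) eq (structures m)
    go refl = Structures.∈-structures⁺ Λ _
  -- The orbit would have `size Λ` distinct points among only `n`.
  ... | no  d≰n = contradiction (Finₚ.injective⇒≤ {f = λ x → word Λ (act t) (proj₁ (index-surj Λ x)) i} inj) d≰n
    where
    inj : Inj (λ x → word Λ (act t) (proj₁ (index-surj Λ x)) i)
    inj {x} {y} eq = trans (sym (proj₂ (index-surj Λ x)))
      (trans (cong (index Λ) (fits-inj Λ (proj₁ (∈-C⁻ t∈)) (proj₂ (∈-C⁻ t∈)) fit eq)) (proj₂ (index-surj Λ y)))

  length-pointed : ∀ n → length (pointed n Λ) ≡ pointedCount ℓ n (size Λ)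
  length-pointed n with size Λ ℕ.≤? n
  ... | no  _   = refl
  ... | yes d≤n = trans (go (ℕₚ.m+[n∸m]≡n d≤n)) (Structures.length-structures Λ _)
    where
    go : ∀ {m n} (eq : size Λ ℕ.+ m ≡ n) →
         length (subst (λ n → List (Vec (Perm n) ℓ × Fin n)) eq (structures m)) ≡ length (structures m)
    go refl = refl

-- Enumeration of sublattices and the double count

elems : ∀ {ℓ} (Λ : Lat ℓ) → List (Q Λ)
elems pt          = tt ∷ []
elems (ext Λ k v) = cartesianProduct (allFin (suc k)) (elems Λ)

elems-unique : ∀ {ℓ} (Λ : Lat ℓ) → Unique (elems Λ)
elems-unique pt          = [] ∷ []
elems-unique (ext Λ k v) = Uniqueₚ.cartesianProduct⁺ (Uniqueₚ.allFin⁺ _) (elems-unique Λ)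

∈-elems : ∀ {ℓ} (Λ : Lat ℓ) q → q ∈ elems Λ
∈-elems pt          q       = here refl
∈-elems (ext Λ k v) (a , q) = ∈-cartesianProduct⁺ (∈-allFin a) (∈-elems Λ q)

length-elems : ∀ {ℓ} (Λ : Lat ℓ) → length (elems Λ) ≡ size Λ
length-elems pt          = refl
length-elems (ext Λ k v) = trans (length-cartesianProduct (allFin (suc k)) (elems Λ))
  (cong₂ ℕ._*_ (Listₚ.length-tabulate {n = suc k} id) (length-elems Λ))

extensions : ∀ {ℓ} → ℕ → Lat ℓ → List (Lat (suc ℓ))
extensions B Λ = map (λ (k , v) → ext Λ (toℕ k) v) (cartesianProduct (allFin B) (elems Λ))

-- Only the individual heights are bounded by `B`, so indices far above `B` occur as well;
-- `pointedCount` gives them the contribution zero.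
lats : ℕ → ∀ ℓ → List (Lat ℓ)
lats B zero    = pt ∷ []
lats B (suc ℓ) = concatMap (extensions B) (lats B ℓ)

lats-unique : ∀ B ℓ → Unique (lats B ℓ)
lats-unique B zero    = [] ∷ []
lats-unique B (suc ℓ) = concatMap-unique (lats-unique B ℓ)
  (λ Λ → Uniqueₚ.map⁺ ext-inj (Uniqueₚ.cartesianProduct⁺ (Uniqueₚ.allFin⁺ B) (elems-unique Λ)))
  disj
  where
  ext-inj : ∀ {Λ : Lat ℓ} {x y : Fin B × Q Λ} →
            ext Λ (toℕ (proj₁ x)) (proj₂ x) ≡ ext Λ (toℕ (proj₁ y)) (proj₂ y) → x ≡ y
  ext-inj {Λ} {k , v} {k′ , v′} eq = cong₂ _,_ (Finₚ.toℕ-injective (proj₁ (parts eq))) (proj₂ (parts eq))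
    where
    parts : ∀ {k k′ v v′} → ext Λ k v ≡ ext Λ k′ v′ → k ≡ k′ × v ≡ v′
    parts refl = refl , refl
  disj : ∀ {Λ Λ′ : Lat ℓ} {Μ} → Μ ∈ extensions B Λ → Μ ∈ extensions B Λ′ → Λ ≡ Λ′
  disj Μ∈ Μ∈′ with ∈-map⁻ _ Μ∈ | ∈-map⁻ _ Μ∈′
  ... | _ , _ , eq | _ , _ , eq′ = cong older (trans (sym eq) eq′)
    where
    older : Lat (suc ℓ) → Lat ℓ
    older (ext Λ _ _) = Λ

∈-lats : ∀ {B n ℓ} {Λ : Lat ℓ} → n ℕ.≤ B → Heights n Λ → Λ ∈ lats B ℓ
∈-lats n≤B pt = here refl
∈-lats {B} n≤B (ext {Λ = Λ} {k} {v} k<n hts) = ∈-concatMap (∈-lats n≤B hts)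
  (subst (λ k → ext Λ k v ∈ extensions B Λ) (Finₚ.toℕ-fromℕ< k<B)
    (∈-map⁺ _ (∈-cartesianProduct⁺ (∈-allFin (Fin.fromℕ< k<B)) (∈-elems Λ v))))
  where k<B = ℕₚ.≤-trans k<n n≤B

-- `fits-exists` puts each pair into some class and `fits-unique` into at most one. `B` is kept
-- apart from `n` so that one list serves all `n` up to `B`.
count-by-stabiliser : ∀ {B n} ℓ → n ℕ.≤ B →
  length (C ℓ n) ℕ.* n ≡ sumℕ (map (λ Λ → pointedCount ℓ n (size Λ)) (lats B ℓ))
count-by-stabiliser {B} {n} ℓ n≤B = begin
  length (C ℓ n) ℕ.* n
    ≡⟨ cong (length (C ℓ n) ℕ.*_) (Listₚ.length-tabulate {n = n} id) ⟨
  length (C ℓ n) ℕ.* length (allFin n)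
    ≡⟨ length-cartesianProduct (C ℓ n) (allFin n) ⟨
  length (cartesianProduct (C ℓ n) (allFin n))
    ≡⟨ length-≡-of-same-members
         (Uniqueₚ.cartesianProduct⁺ (C-unique ℓ n) (Uniqueₚ.allFin⁺ n))
         (concatMap-unique (lats-unique B ℓ) (λ Λ → pointed-unique Λ n) disj) to from ⟩
  length (concatMap (pointed n) (lats B ℓ))
    ≡⟨ length-concatMap (lats B ℓ) ⟩
  sumℕ (map (length ∘ pointed n) (lats B ℓ))
    ≡⟨ cong sumℕ (Listₚ.map-cong (λ Λ → length-pointed Λ n) (lats B ℓ)) ⟩
  sumℕ (map (λ Λ → pointedCount ℓ n (size Λ)) (lats B ℓ)) ∎
  where
  open ≡-Reasoning
  disj : ∀ {Λ Λ′ : Lat ℓ} {ti} → ti ∈ pointed n Λ → ti ∈ pointed n Λ′ → Λ ≡ Λ′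
  disj {Λ} {Λ′} ti∈ ti∈′ =
    let t∈ , fit  = ∈-pointed⁻ Λ ti∈
        _  , fit′ = ∈-pointed⁻ Λ′ ti∈′
    in fits-unique Λ Λ′ (proj₁ (∈-C⁻ t∈)) (proj₂ (∈-C⁻ t∈)) fit fit′
  to : ∀ {ti} → ti ∈ cartesianProduct (C ℓ n) (allFin n) → ti ∈ concatMap (pointed n) (lats B ℓ)
  to {t , i} ti∈ =
    let t∈ , _ = ∈-cartesianProduct⁻ (C ℓ n) (allFin n) ti∈
        Λ , hts , fit = fits-exists (act t) (proj₂ (∈-C⁻ t∈)) i
    in ∈-concatMap (∈-lats n≤B hts) (∈-pointed⁺ Λ t∈ fit)
  from : ∀ {ti} → ti ∈ concatMap (pointed n) (lats B ℓ) → ti ∈ cartesianProduct (C ℓ n) (allFin n)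
  from {t , i} ti∈ =
    let Λ , _ , ti∈Λ = find (∈-concatMap⁻ (pointed n) {xs = lats B ℓ} ti∈)
    in ∈-cartesianProduct⁺ (proj₁ (∈-pointed⁻ Λ ti∈Λ)) (∈-allFin i)

-- Finite sums

indicator : Bool → ℕ
indicator b = if b then 1 else 0

sum-zero : ∀ {n} {f : Fin n → ℕ} → (∀ i → f i ≡ 0) → sum f ≡ 0
sum-zero {zero}  f≡0 = refl
sum-zero {suc n} f≡0 = cong₂ ℕ._+_ (f≡0 zero) (sum-zero (f≡0 ∘ suc))

sumℕ-concatMap : {A B : Set} (h : B → ℕ) (f : A → List B) (xs : List A) →
                 sumℕ (map h (concatMap f xs)) ≡ sumℕ (map (λ x → sumℕ (map h (f x))) xs)
sumℕ-concatMap h f []       = refl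
sumℕ-concatMap h f (x ∷ xs) = trans (cong sumℕ (Listₚ.map-++ h (f x) _))
  (trans (sum-++ (map h (f x)) _) (cong (sumℕ (map h (f x)) ℕ.+_) (sumℕ-concatMap h f xs)))

sumℕ-const : {A : Set} (a : ℕ) (xs : List A) → sumℕ (map (λ _ → a) xs) ≡ length xs ℕ.* a
sumℕ-const a []       = refl
sumℕ-const a (x ∷ xs) = cong (a ℕ.+_) (sumℕ-const a xs)

sumℕ-tabulate : ∀ {n} {A : Set} (h : A → ℕ) (f : Fin n → A) → sumℕ (map h (List.tabulate f)) ≡ sum (h ∘ f)
sumℕ-tabulate {zero}  h f = refl
sumℕ-tabulate {suc n} h f = cong (h (f zero) ℕ.+_) (sumℕ-tabulate h (f ∘ suc))

sumℕ-cartesianProduct : {A B : Set} (h : A → ℕ) (xs : List A) (ys : List B) →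
  sumℕ (map (h ∘ proj₁) (cartesianProduct xs ys)) ≡ sumℕ (map (λ x → length ys ℕ.* h x) xs)
sumℕ-cartesianProduct h []       ys = refl
sumℕ-cartesianProduct h (x ∷ xs) ys = trans (cong sumℕ (Listₚ.map-++ (h ∘ proj₁) (map (x ,_) ys) _))
  (trans (sum-++ (map (h ∘ proj₁) (map (x ,_) ys)) _)
    (cong₂ ℕ._+_ (trans (cong sumℕ (sym (Listₚ.map-∘ ys))) (sumℕ-const (h x) ys))
               (sumℕ-cartesianProduct h xs ys)))

-- A Kronecker delta expansion, used to regroup sums over multiples of e as sums over all indices d.
sum-indicator : ∀ B y (f : ℕ → ℕ) → (B ℕ.≤ y → f y ≡ 0) →
                f y ≡ sum (λ (d : Fin B) → indicator (y ≡ᵇ toℕ d) ℕ.* f (toℕ d))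
sum-indicator zero    y       f f≡0 = f≡0 z≤n
sum-indicator (suc B) zero    f f≡0 = sym (trans
  (cong₂ ℕ._+_ (ℕₚ.*-identityˡ (f 0)) (sum-zero {B} (λ _ → refl))) (ℕₚ.+-identityʳ (f 0)))
sum-indicator (suc B) (suc y) f f≡0 = sum-indicator B y (f ∘ suc) (f≡0 ∘ s≤s)

-- Counting sublattices by index; the index d ∈ {1, …, B} is encoded by d - 1 : Fin B.

-- The sum over `k` is 1 or 0 according to whether e + 1 divides d + 1; the last factor counts the
-- cosets available for `v`.
divisorWeight : ∀ B → Fin B → Fin B → ℕ
divisorWeight B d e = sum (λ (k : Fin B) → indicator (suc (toℕ k) ℕ.* suc (toℕ e) ≡ᵇ suc (toℕ d))) ℕ.* suc (toℕ e)

latCount : ∀ B → ℕ → Fin B → ℕ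
latCount B zero    d = indicator (toℕ d ≡ᵇ 0)
latCount B (suc ℓ) d = sum (λ e → divisorWeight B d e ℕ.* latCount B ℓ e)

-- Summing over the extensions of Λ turns `h` into a weight `h′` of the index of Λ alone, hence the
-- induction with `h` general. Vanishing beyond `suc b` survives because multiples of a large index
-- are large.
sum-lats : ∀ {b} ℓ (h : ℕ → ℕ) → (∀ x → suc b ℕ.< x → h x ≡ 0) →
           sumℕ (map (h ∘ size) (lats (suc b) ℓ))
             ≡ sum (λ d → latCount (suc b) ℓ d ℕ.* h (suc (toℕ d)))
sum-lats {b} zero    h h≡0 = sym (cong₂ ℕ._+_ (ℕₚ.*-identityˡ (h 1)) (sum-zero {b} (λ _ → refl)))
sum-lats {b} (suc ℓ) h h≡0 = begin
  sumℕ (map (h ∘ size) (concatMap (extensions B) (lats B ℓ)))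
    ≡⟨ sumℕ-concatMap (h ∘ size) (extensions B) (lats B ℓ) ⟩
  sumℕ (map (λ Λ → sumℕ (map (h ∘ size) (extensions B Λ))) (lats B ℓ))
    ≡⟨ cong sumℕ (Listₚ.map-cong sum-extensions (lats B ℓ)) ⟩
  sumℕ (map (h′ ∘ size) (lats B ℓ))
    ≡⟨ sum-lats ℓ h′ h′≡0 ⟩
  sum (λ e → g e ℕ.* h′ (suc (toℕ e)))
    ≡⟨ sum-cong-≗ expand ⟩
  sum (λ e → sum (λ d → divisorWeight B d e ℕ.* g e ℕ.* h (suc (toℕ d))))
    ≡⟨ ∑-comm (λ e d → divisorWeight B d e ℕ.* g e ℕ.* h (suc (toℕ d))) ⟩
  sum (λ d → sum (λ e → divisorWeight B d e ℕ.* g e ℕ.* h (suc (toℕ d))))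
    ≡⟨ sum-cong-≗ (λ d → *-distribʳ-sum (h (suc (toℕ d))) (λ e → divisorWeight B d e ℕ.* g e)) ⟨
  sum (λ d → sum (λ e → divisorWeight B d e ℕ.* g e) ℕ.* h (suc (toℕ d))) ∎
  where
  open ≡-Reasoning
  B = suc b
  g = latCount B ℓ
  h′ : ℕ → ℕ
  h′ e = sum (λ (k : Fin B) → e ℕ.* h (suc (toℕ k) ℕ.* e))

  sum-extensions : ∀ (Λ : Lat ℓ) → sumℕ (map (h ∘ size) (extensions B Λ)) ≡ h′ (size Λ)
  sum-extensions Λ = trans (cong sumℕ (sym (Listₚ.map-∘ (cartesianProduct (allFin B) (elems Λ)))))
    (trans (sumℕ-cartesianProduct (λ (k : Fin B) → h (suc (toℕ k) ℕ.* size Λ)) (allFin B) (elems Λ))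
      (trans (sumℕ-tabulate {B} (λ k → length (elems Λ) ℕ.* h (suc (toℕ k) ℕ.* size Λ)) id)
             (cong (λ e → sum (λ (k : Fin B) → e ℕ.* h (suc (toℕ k) ℕ.* size Λ))) (length-elems Λ))))

  h′≡0 : ∀ x → B ℕ.< x → h′ x ≡ 0
  h′≡0 x B<x = sum-zero (λ (k : Fin B) → trans
    (cong (x ℕ.*_) (h≡0 (suc (toℕ k) ℕ.* x) (ℕₚ.≤-trans B<x (ℕₚ.m≤m+n x (toℕ k ℕ.* x)))))
    (ℕₚ.*-zeroʳ x))

  hit : Fin B → Fin B → Fin B → ℕ
  hit e k d = indicator (suc (toℕ k) ℕ.* suc (toℕ e) ≡ᵇ suc (toℕ d))

  expand : ∀ e → g e ℕ.* h′ (suc (toℕ e)) ≡ sum (λ d → divisorWeight B d e ℕ.* g e ℕ.* h (suc (toℕ d)))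
  expand e = begin
    g e ℕ.* sum (λ (k : Fin B) → s ℕ.* h (suc (toℕ k) ℕ.* s))
      ≡⟨ *-distribˡ-sum (g e) (λ (k : Fin B) → s ℕ.* h (suc (toℕ k) ℕ.* s)) ⟩
    sum (λ (k : Fin B) → g e ℕ.* (s ℕ.* h (suc (toℕ k) ℕ.* s)))
      ≡⟨ sum-cong-≗ {B} (λ k → trans
           (cong (λ y → g e ℕ.* (s ℕ.* y)) (sum-indicator B (toℕ e ℕ.+ toℕ k ℕ.* s) (h ∘ suc) (λ B≤y → h≡0 _ (s≤s B≤y))))
           (trans (sym (ℕₚ.*-assoc (g e) s _))
             (*-distribˡ-sum (g e ℕ.* s) (λ d → hit e k d ℕ.* h (suc (toℕ d)))))) ⟩
    sum (λ k → sum (λ d → g e ℕ.* s ℕ.* (hit e k d ℕ.* h (suc (toℕ d)))))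
      ≡⟨ ∑-comm (λ k d → g e ℕ.* s ℕ.* (hit e k d ℕ.* h (suc (toℕ d)))) ⟩
    sum (λ d → sum (λ k → g e ℕ.* s ℕ.* (hit e k d ℕ.* h (suc (toℕ d)))))
      ≡⟨ sum-cong-≗ (λ d → trans
           (sum-cong-≗ (λ k → solve 4 (λ g s x y → g :* s :* (x :* y) := x :* (s :* g :* y)) refl
             (g e) s (hit e k d) (h (suc (toℕ d)))))
           (trans (sym (*-distribʳ-sum (s ℕ.* g e ℕ.* h (suc (toℕ d))) (λ k → hit e k d)))
             (solve 4 (λ a s g y → a :* (s :* g :* y) := a :* s :* g :* y) refl
               (sum (λ k → hit e k d)) s (g e) (h (suc (toℕ d)))))) ⟩
    sum (λ d → divisorWeight B d e ℕ.* g e ℕ.* h (suc (toℕ d))) ∎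
    where
    open ℕSolver.+-*-Solver
    s = suc (toℕ e)

-- The recurrence for the number of commuting tuples

count : ℕ → ℕ → ℕ
count ℓ n = length (C ℓ n)

count-zero : ∀ ℓ → count ℓ 0 ≡ 1
count-zero ℓ = length-≡-of-same-members {ys = replicate ℓ [] ∷ []} (C-unique ℓ 0) ([] ∷ [])
  (λ {t} _ → here (act-ext (λ j ())))
  (λ { (here refl) → ∈-C⁺ _ (λ j k ()) (λ j {}) })

-- Entry `i` belongs to index i + 1 on m + 1 points. The guard silences i > m, where truncated
-- subtraction would yield `c 0`; the offset `j` serves the induction in `conv-sum`.
term : (ℕ → ℕ) → ℕ → ℕ → ℕ → ℕ
term c j m i = if i <ᵇ suc m then fall (j ℕ.+ i) (m ∸ i) ℕ.* c (m ∸ i) else 0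

-- The top factor of the falling factorial is n + 1, the number of points to mark; pulling it out
-- allows cancellation within ℕ.
pointedCount-suc : ∀ ℓ n i → pointedCount ℓ (suc n) (suc i) ≡ suc n ℕ.* term (count ℓ) 0 n i
pointedCount-suc ℓ n i with suc i ℕ.≤? suc n
... | yes i<n rewrite Equivalence.to T-≡ (ℕₚ.<⇒<ᵇ i<n) = trans (ℕₚ.*-assoc (suc (i ℕ.+ (n ∸ i))) (fall i (n ∸ i)) (count ℓ (n ∸ i)))
  (cong (λ k → suc k ℕ.* (fall i (n ∸ i) ℕ.* count ℓ (n ∸ i))) (ℕₚ.m+[n∸m]≡n (ℕₚ.≤-pred i<n)))
... | no  i≮n with i <ᵇ suc n in eq
...   | true  = contradiction (ℕₚ.<ᵇ⇒< i (suc n) (Equivalence.from T-≡ eq)) i≮n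
...   | false = sym (ℕₚ.*-zeroʳ n)

count-suc : ∀ {b} ℓ {n} → n ℕ.≤ b →
            count ℓ (suc n) ≡ sum (λ d → latCount (suc b) ℓ d ℕ.* term (count ℓ) 0 n (toℕ d))
count-suc {b} ℓ {n} n≤b = ℕₚ.*-cancelʳ-≡ _ _ (suc n) (begin
  count ℓ (suc n) ℕ.* suc n
    ≡⟨ count-by-stabiliser ℓ (s≤s n≤b) ⟩
  sumℕ (map (pointedCount ℓ (suc n) ∘ size) (lats (suc b) ℓ))
    ≡⟨ sum-lats ℓ (pointedCount ℓ (suc n)) large ⟩
  sum (λ d → g d ℕ.* pointedCount ℓ (suc n) (suc (toℕ d)))
    ≡⟨ sum-cong-≗ (λ d → trans (cong (g d ℕ.*_) (pointedCount-suc ℓ n (toℕ d)))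
         (solve 3 (λ g n t → g :* (n :* t) := g :* t :* n) refl (g d) (suc n) _)) ⟩
  sum (λ d → g d ℕ.* term (count ℓ) 0 n (toℕ d) ℕ.* suc n)
    ≡⟨ *-distribʳ-sum (suc n) (λ d → g d ℕ.* term (count ℓ) 0 n (toℕ d)) ⟨
  sum (λ d → g d ℕ.* term (count ℓ) 0 n (toℕ d)) ℕ.* suc n ∎)
  where
  open ≡-Reasoning
  open ℕSolver.+-*-Solver
  g = latCount (suc b) ℓ
  large : ∀ x → suc b ℕ.< x → pointedCount ℓ (suc n) x ≡ 0
  large x b<x with x ℕ.≤? suc n
  ... | yes x≤n = contradiction (ℕₚ.≤-trans b<x (ℕₚ.≤-trans x≤n (s≤s n≤b))) ℕₚ.1+n≰n
  ... | no  _   = refl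

-- One program for the recurrence over different value types

down : {A : Set} → (ℕ → A) → ℕ → List A
down f zero    = f 0 ∷ []
down f (suc n) = f (suc n) ∷ down f n

length-down : {A : Set} (f : ℕ → A) (n : ℕ) → length (down f n) ≡ suc n
length-down f zero    = refl
length-down f (suc n) = cong suc (length-down f n)

-- The recurrence is run over ℕ for a single ℓ and over exponential sums for all ℓ at once. Values
-- are stored in descending order, so the length of the tail tells how many points remain.
record Ops (A : Set) : Set where
  field
    0#      : A
    _⊕_ _⊛_ : A → A → A
    _⊙_     : ℕ → A → A

  -- The lists hold g (j + 1), g (j + 2), … and c m, c (m - 1), …, c 0.
  conv : ℕ → List A → List A → A
  conv j []       _        = 0#
  conv j (g ∷ gs) []       = 0#
  conv j (g ∷ gs) (c ∷ cs) = (g ⊛ (fall j (length cs) ⊙ c)) ⊕ conv (suc j) gs cs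

  extend : List A → List A → List A
  extend gs cs = conv 0 gs cs ∷ cs

  build : A → List A → ℕ → List A
  build c₀ gs zero    = c₀ ∷ []
  build c₀ gs (suc n) = extend gs (build c₀ gs n)

  combination : ∀ {n} → (Fin n → ℕ) → (Fin n → A) → A
  combination {zero}  w x = 0#
  combination {suc n} w x = (w zero ⊙ x zero) ⊕ combination (w ∘ suc) (x ∘ suc)

ℕ-ops : Ops ℕ
ℕ-ops = record { 0# = 0 ; _⊕_ = ℕ._+_ ; _⊛_ = ℕ._*_ ; _⊙_ = ℕ._*_ }

module ℕ-Ops = Ops ℕ-ops

conv-sum : ∀ {b} (c : ℕ → ℕ) j m (g : Fin b → ℕ) →
           ℕ-Ops.conv j (List.tabulate g) (down c m) ≡ sum (λ i → g i ℕ.* term c j m (toℕ i))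
conv-sum {zero}  c j m       g = refl
conv-sum {suc b} c j zero    g = cong₂ ℕ._+_
  (cong (λ j → g zero ℕ.* (fall j 0 ℕ.* c 0)) (sym (ℕₚ.+-identityʳ j)))
  (trans (conv-[] (List.tabulate (g ∘ suc))) (sym (sum-zero (λ i → ℕₚ.*-zeroʳ (g (suc i))))))
  where
  conv-[] : ∀ gs → ℕ-Ops.conv (suc j) gs [] ≡ 0
  conv-[] []       = refl
  conv-[] (g ∷ gs) = refl
conv-sum {suc b} c j (suc m) g = cong₂ ℕ._+_
  (cong₂ (λ j m → g zero ℕ.* (fall j m ℕ.* c (suc _))) (sym (ℕₚ.+-identityʳ j)) (length-down c m))
  (trans (conv-sum c (suc j) m (g ∘ suc))
    (sum-cong-≗ (λ i → cong (λ k → g (suc i) ℕ.* (if toℕ i <ᵇ suc m then fall k (m ∸ toℕ i) ℕ.* c (m ∸ toℕ i) else 0))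
      (sym (ℕₚ.+-suc j (toℕ i))))))

build-down : ∀ {b} (c : ℕ → ℕ) (g : Fin b → ℕ) {N} →
             (∀ n → n ℕ.< N → c (suc n) ≡ sum (λ d → g d ℕ.* term c 0 n (toℕ d))) →
             ℕ-Ops.build (c 0) (List.tabulate g) N ≡ down c N
build-down c g {zero}  rec = refl
build-down c g {suc N} rec = trans
  (cong (ℕ-Ops.extend (List.tabulate g)) (build-down c g (λ n n<N → rec n (ℕₚ.m≤n⇒m≤1+n n<N))))
  (cong (_∷ down c N) (trans (conv-sum c 0 N g) (sym (rec N (ℕₚ.n<1+n N)))))

-- The recurrence is homogeneous: index d and d-free remainder m have d + m = n + 1, so the power of
-- `S` splits between them. This clears the denominators of the coefficients.
scaled-rec : ∀ {b} (S : ℕ) (c : ℕ → ℕ) (g : Fin b → ℕ) n →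
  c (suc n) ≡ sum (λ d → g d ℕ.* term c 0 n (toℕ d)) →
  S ℕ.^ suc n ℕ.* c (suc n) ≡ sum (λ d → (S ℕ.^ suc (toℕ d) ℕ.* g d) ℕ.* term (λ m → S ℕ.^ m ℕ.* c m) 0 n (toℕ d))
scaled-rec S c g n rec = trans (cong (S ℕ.^ suc n ℕ.*_) rec)
  (trans (*-distribˡ-sum (S ℕ.^ suc n) (λ d → g d ℕ.* term c 0 n (toℕ d))) (sum-cong-≗ λ d → scaled (toℕ d) (g d)))
  where
  open ℕSolver.+-*-Solver
  scaled : ∀ i g → S ℕ.^ suc n ℕ.* (g ℕ.* term c 0 n i) ≡ (S ℕ.^ suc i ℕ.* g) ℕ.* term (λ m → S ℕ.^ m ℕ.* c m) 0 n i
  scaled i g with i <ᵇ suc n in eq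
  ... | false = trans (cong (S ℕ.^ suc n ℕ.*_) (ℕₚ.*-zeroʳ g))
                      (trans (ℕₚ.*-zeroʳ (S ℕ.^ suc n)) (sym (ℕₚ.*-zeroʳ (S ℕ.^ suc i ℕ.* g))))
  ... | true  = trans
    (cong (ℕ._* (g ℕ.* (fall i (n ∸ i) ℕ.* c (n ∸ i)))) (trans (cong (S ℕ.^_) (cong suc (sym (ℕₚ.m+[n∸m]≡n i≤n))))
      (ℕₚ.^-distribˡ-+-* S (suc i) (n ∸ i))))
    (solve 5 (λ x y g f c → (x :* y) :* (g :* (f :* c)) := (x :* g) :* (f :* (y :* c))) refl
      (S ℕ.^ suc i) (S ℕ.^ (n ∸ i)) g (fall i (n ∸ i)) (c (n ∸ i)))
    where
    i≤n : i ℕ.≤ n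
    i≤n = ℕₚ.≤-pred (ℕₚ.<ᵇ⇒< i (suc n) (Equivalence.from T-≡ eq))

-- The list of pairs (c , b) stands for the function ℓ ↦ Σ c · b^ℓ.
ExpSum : Set
ExpSum = List (ℤ × ℕ)

eval : ℕ → ExpSum → ℤ
eval ℓ []            = 0ℤ
eval ℓ ((c , b) ∷ p) = c * + (b ℕ.^ ℓ) + eval ℓ p

-- Cancelled terms have to vanish from the list: emptiness certifies an identity in `defect`, and
-- `settled` takes the head for the leading term.
consNonZero : ℤ → ℕ → ExpSum → ExpSum
consNonZero (+ 0) b p = p
consNonZero c     b p = (c , b) ∷ p

-- Correct for all lists, but like terms are only sure to be combined when both
-- lists are sorted by decreasing base.
infixr 6 _⊞_
_⊞_ : ExpSum → ExpSum → ExpSum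
[]            ⊞ q             = q
(t ∷ p)       ⊞ []            = t ∷ p
((c , b) ∷ p) ⊞ ((d , e) ∷ q) =
  if b ≡ᵇ e then consNonZero (c + d) b (p ⊞ q)
  else if e <ᵇ b then (c , b) ∷ (p ⊞ ((d , e) ∷ q))
  else (d , e) ∷ (((c , b) ∷ p) ⊞ q)

scale : ℤ → ExpSum → ExpSum
scale a []            = []
scale a ((c , b) ∷ p) = consNonZero (a * c) b (scale a p)

shift : ExpSum → ExpSum
shift = map (λ (c , b) → c * + b , b)

monomial : ℤ × ℕ → ExpSum → ExpSum
monomial (c , b) = map (λ (d , e) → c * d , b ℕ.* e)

evens odds : ExpSum → ExpSum
evens []          = []
evens (t ∷ p)     = t ∷ odds p
odds []           = []
odds (t ∷ p)      = evens p

-- The first argument is the depth of a balanced splitting of the left factor,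
-- which keeps the cost of the merges down.
product : ℕ → ExpSum → ExpSum → ExpSum
product (suc k) p       q = product k (evens p) q ⊞ product k (odds p) q
product zero    []      q = []
product zero    (t ∷ p) q = monomial t q ⊞ product zero p q

infixr 7 _⊠_
_⊠_ : ExpSum → ExpSum → ExpSum
_⊠_ = product 8

expSum-ops : Ops ExpSum
expSum-ops = record { 0# = [] ; _⊕_ = _⊞_ ; _⊛_ = _⊠_ ; _⊙_ = λ n → scale (+ n) }

module ES = Ops expSum-ops

-- Correctness of the arithmetic of exponential sums

^-distribʳ-* : ∀ ℓ a b → (a ℕ.* b) ℕ.^ ℓ ≡ a ℕ.^ ℓ ℕ.* b ℕ.^ ℓ
^-distribʳ-* zero    a b = refl
^-distribʳ-* (suc ℓ) a b = trans (cong (λ y → a ℕ.* b ℕ.* y) (^-distribʳ-* ℓ a b))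
  (solve 4 (λ a b x y → a :* b :* (x :* y) := a :* x :* (b :* y)) refl a b (a ℕ.^ ℓ) (b ℕ.^ ℓ))
  where open ℕSolver.+-*-Solver

module _ (ℓ : ℕ) where

  open ℤSolver.+-*-Solver

  eval-consNonZero : ∀ c b p → eval ℓ (consNonZero c b p) ≡ c * + (b ℕ.^ ℓ) + eval ℓ p
  eval-consNonZero (+ 0)       b p = sym (trans (cong (λ y → y + eval ℓ p) (ℤₚ.*-zeroˡ (+ (b ℕ.^ ℓ)))) (ℤₚ.+-identityˡ _))
  eval-consNonZero (+ (suc _)) b p = refl
  eval-consNonZero -[1+ _ ]    b p = refl

  eval-⊞ : ∀ p q → eval ℓ (p ⊞ q) ≡ eval ℓ p + eval ℓ q
  eval-⊞ []      q       = sym (ℤₚ.+-identityˡ _)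
  eval-⊞ (t ∷ p) []      = sym (ℤₚ.+-identityʳ _)
  eval-⊞ (t ∷ p) (u ∷ q) = step t u (eval-⊞ p q) (eval-⊞ p (u ∷ q)) (eval-⊞ (t ∷ p) q)
    where
    step : ∀ t u → eval ℓ (p ⊞ q) ≡ eval ℓ p + eval ℓ q →
           eval ℓ (p ⊞ (u ∷ q)) ≡ eval ℓ p + eval ℓ (u ∷ q) →
           eval ℓ ((t ∷ p) ⊞ q) ≡ eval ℓ (t ∷ p) + eval ℓ q →
           eval ℓ ((t ∷ p) ⊞ (u ∷ q)) ≡ eval ℓ (t ∷ p) + eval ℓ (u ∷ q)
    step (c , b) (d , e) both left right with b ≡ᵇ e in eq | e <ᵇ b
    ... | true  | _     rewrite ℕₚ.≡ᵇ⇒≡ b e (Equivalence.from T-≡ eq) =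
      trans (eval-consNonZero (c + d) e (p ⊞ q)) (trans (cong (λ y → (c + d) * + (e ℕ.^ ℓ) + y) both)
        (solve 5 (λ c d x p q → (c :+ d) :* x :+ (p :+ q) := (c :* x :+ p) :+ (d :* x :+ q)) refl
          c d (+ (e ℕ.^ ℓ)) (eval ℓ p) (eval ℓ q)))
    ... | false | true  = trans (cong (λ y → c * + (b ℕ.^ ℓ) + y) left)
      (sym (ℤₚ.+-assoc (c * + (b ℕ.^ ℓ)) (eval ℓ p) _))
    ... | false | false = trans (cong (λ y → d * + (e ℕ.^ ℓ) + y) right)
      (solve 3 (λ x y z → x :+ (y :+ z) := y :+ (x :+ z)) refl
        (d * + (e ℕ.^ ℓ)) (eval ℓ ((c , b) ∷ p)) (eval ℓ q))

  eval-scale : ∀ a p → eval ℓ (scale a p) ≡ a * eval ℓ p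
  eval-scale a []            = sym (ℤₚ.*-zeroʳ a)
  eval-scale a ((c , b) ∷ p) = trans (eval-consNonZero (a * c) b (scale a p)) (trans (cong (λ y → a * c * + (b ℕ.^ ℓ) + y) (eval-scale a p))
    (solve 4 (λ a c x p → a :* c :* x :+ a :* p := a :* (c :* x :+ p)) refl a c (+ (b ℕ.^ ℓ)) (eval ℓ p)))

  eval-shift : ∀ p → eval ℓ (shift p) ≡ eval (suc ℓ) p
  eval-shift []            = refl
  eval-shift ((c , b) ∷ p) = cong₂ _+_
    (trans (ℤₚ.*-assoc c (+ b) _) (cong (c *_) (sym (ℤₚ.pos-* b (b ℕ.^ ℓ))))) (eval-shift p)

  eval-monomial : ∀ c b q → eval ℓ (monomial (c , b) q) ≡ c * + (b ℕ.^ ℓ) * eval ℓ q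
  eval-monomial c b []            = sym (ℤₚ.*-zeroʳ (c * + (b ℕ.^ ℓ)))
  eval-monomial c b ((d , e) ∷ q) = trans
    (cong₂ _+_ (cong (c * d *_) (trans (cong +_ (^-distribʳ-* ℓ b e)) (ℤₚ.pos-* (b ℕ.^ ℓ) (e ℕ.^ ℓ))))
               (eval-monomial c b q))
    (solve 5 (λ c d x y q → c :* d :* (x :* y) :+ c :* x :* q := c :* x :* (d :* y :+ q)) refl
      c d (+ (b ℕ.^ ℓ)) (+ (e ℕ.^ ℓ)) (eval ℓ q))

  eval-evens-odds : ∀ p → eval ℓ (evens p) + eval ℓ (odds p) ≡ eval ℓ p
  eval-evens-odds []            = refl
  eval-evens-odds ((c , b) ∷ p) = trans
    (solve 3 (λ x y z → x :+ y :+ z := x :+ (z :+ y)) refl (c * + (b ℕ.^ ℓ)) (eval ℓ (odds p)) (eval ℓ (evens p)))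
    (cong (λ y → c * + (b ℕ.^ ℓ) + y) (eval-evens-odds p))

  eval-product : ∀ k p q → eval ℓ (product k p q) ≡ eval ℓ p * eval ℓ q
  eval-product (suc k) p q = trans (eval-⊞ (product k (evens p) q) (product k (odds p) q))
    (trans (cong₂ _+_ (eval-product k (evens p) q) (eval-product k (odds p) q))
      (trans (sym (ℤₚ.*-distribʳ-+ (eval ℓ q) (eval ℓ (evens p)) (eval ℓ (odds p))))
             (cong (_* eval ℓ q) (eval-evens-odds p))))
  eval-product zero []            q = sym (ℤₚ.*-zeroˡ (eval ℓ q))
  eval-product zero ((c , b) ∷ p) q = trans (eval-⊞ (monomial (c , b) q) (product zero p q))
    (trans (cong₂ _+_ (eval-monomial c b q) (eval-product zero p q))
           (sym (ℤₚ.*-distribʳ-+ (eval ℓ q) (c * + (b ℕ.^ ℓ)) (eval ℓ p))))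

  Represents : ExpSum → ℕ → Set
  Represents p x = eval ℓ p ≡ + x

  represents-⊞ : ∀ {p q x y} → Represents p x → Represents q y → Represents (p ⊞ q) (x ℕ.+ y)
  represents-⊞ {p} {q} rp rq = trans (eval-⊞ p q) (cong₂ _+_ rp rq)

  represents-⊠ : ∀ {p q x y} → Represents p x → Represents q y → Represents (p ⊠ q) (x ℕ.* y)
  represents-⊠ {p} {q} {x} {y} rp rq = trans (eval-product 8 p q) (trans (cong₂ _*_ rp rq) (sym (ℤₚ.pos-* x y)))

  represents-⊙ : ∀ {p x} n → Represents p x → Represents (scale (+ n) p) (n ℕ.* x)
  represents-⊙ {p} {x} n rp = trans (eval-scale (+ n) p) (trans (cong (λ y → + n * y) rp) (sym (ℤₚ.pos-* n x)))

  represents-conv : ∀ j {gs gs′ cs cs′} → Pointwise Represents gs gs′ → Pointwise Represents cs cs′ →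
                    Represents (ES.conv j gs cs) (ℕ-Ops.conv j gs′ cs′)
  represents-conv j []         _          = refl
  represents-conv j (rg ∷ rgs) []         = refl
  represents-conv j {g ∷ gs} {_} {c ∷ cs} {c′ ∷ _} (rg ∷ rgs) (rc ∷ rcs) =
    represents-⊞ {g ⊠ scale (+ fall j (length cs)) c}
      (represents-⊠ {g} rg (trans (represents-⊙ {c} (fall j (length cs)) rc)
        (cong (λ n → + (fall j n ℕ.* c′)) (Pointwise-length rcs))))
      (represents-conv (suc j) rgs rcs)

  represents-build : ∀ {c₀ c₀′ gs gs′} → Represents c₀ c₀′ → Pointwise Represents gs gs′ → ∀ n →
                     Pointwise Represents (ES.build c₀ gs n) (ℕ-Ops.build c₀′ gs′ n)
  represents-build r₀ rgs zero    = r₀ ∷ []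
  represents-build r₀ rgs (suc n) = represents-conv 0 rgs (represents-build r₀ rgs n) ∷ represents-build r₀ rgs n

  represents-combination : ∀ {n} (w : Fin n → ℕ) (x : Fin n → ExpSum) (x′ : Fin n → ℕ) →
    (∀ i → Represents (x i) (x′ i)) → Represents (ES.combination w x) (sum (λ i → w i ℕ.* x′ i))
  represents-combination {zero}  w x x′ rx = refl
  represents-combination {suc n} w x x′ rx = represents-⊞ {scale (+ w zero) (x zero)}
    (represents-⊙ {x zero} (w zero) (rx zero))
    (represents-combination (w ∘ suc) (x ∘ suc) (x′ ∘ suc) (rx ∘ suc))

-- Sign of an exponential sum dominated by its leading term

mass : ℕ → ExpSum → ℕ
mass ℓ []            = 0
mass ℓ ((c , b) ∷ p) = ∣ c ∣ ℕ.* b ℕ.^ ℓ ℕ.+ mass ℓ p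

∣eval∣≤mass : ∀ ℓ p → ∣ eval ℓ p ∣ ℕ.≤ mass ℓ p
∣eval∣≤mass ℓ []            = z≤n
∣eval∣≤mass ℓ ((c , b) ∷ p) = ℕₚ.≤-trans (ℤₚ.∣i+j∣≤∣i∣+∣j∣ (c * + (b ℕ.^ ℓ)) (eval ℓ p))
  (ℕₚ.+-mono-≤ (ℕₚ.≤-reflexive (ℤₚ.abs-* c (+ (b ℕ.^ ℓ)))) (∣eval∣≤mass ℓ p))

basesUpTo : ℕ → ExpSum → Bool
basesUpTo b []            = true
basesUpTo b ((c , e) ∷ p) = (e ≤ᵇ b) ∧ basesUpTo b p

-- From L to L + k each term grows by at most b^k, and a leading term of base b by exactly b^k. Thus
-- a single comparison at L settles all larger exponents.
mass-growth : ∀ L k b p → T (basesUpTo b p) → mass (L ℕ.+ k) p ℕ.≤ mass L p ℕ.* b ℕ.^ k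
mass-growth L k b []            _  = z≤n
mass-growth L k b ((c , e) ∷ p) ok = begin
  ∣ c ∣ ℕ.* e ℕ.^ (L ℕ.+ k) ℕ.+ mass (L ℕ.+ k) p
    ≤⟨ ℕₚ.+-mono-≤ head (mass-growth L k b p (proj₂ both)) ⟩
  ∣ c ∣ ℕ.* e ℕ.^ L ℕ.* b ℕ.^ k ℕ.+ mass L p ℕ.* b ℕ.^ k
    ≡⟨ ℕₚ.*-distribʳ-+ (b ℕ.^ k) (∣ c ∣ ℕ.* e ℕ.^ L) (mass L p) ⟨
  (∣ c ∣ ℕ.* e ℕ.^ L ℕ.+ mass L p) ℕ.* b ℕ.^ k ∎
  where
  open ℕₚ.≤-Reasoning
  both = Equivalence.to T-∧ ok
  head : ∣ c ∣ ℕ.* e ℕ.^ (L ℕ.+ k) ℕ.≤ ∣ c ∣ ℕ.* e ℕ.^ L ℕ.* b ℕ.^ k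
  head = begin
    ∣ c ∣ ℕ.* e ℕ.^ (L ℕ.+ k)        ≡⟨ cong (∣ c ∣ ℕ.*_) (ℕₚ.^-distribˡ-+-* e L k) ⟩
    ∣ c ∣ ℕ.* (e ℕ.^ L ℕ.* e ℕ.^ k)  ≡⟨ ℕₚ.*-assoc ∣ c ∣ (e ℕ.^ L) (e ℕ.^ k) ⟨
    ∣ c ∣ ℕ.* e ℕ.^ L ℕ.* e ℕ.^ k    ≤⟨ ℕₚ.*-monoʳ-≤ (∣ c ∣ ℕ.* e ℕ.^ L) (ℕₚ.^-monoˡ-≤ k (ℕₚ.≤ᵇ⇒≤ e b (proj₁ both))) ⟩
    ∣ c ∣ ℕ.* e ℕ.^ L ℕ.* b ℕ.^ k    ∎

dominated : ℕ → ℕ → ℕ → ExpSum → Bool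
dominated L a b p = (1 ≤ᵇ b) ∧ basesUpTo b p ∧ (mass L p <ᵇ a ℕ.* b ℕ.^ L)

dominated-sound : ∀ L k a b p → T (dominated L a b p) →
                  ∣ eval (L ℕ.+ k) p ∣ ℕ.< a ℕ.* b ℕ.^ (L ℕ.+ k)
dominated-sound L k a b p ok = begin-strict
  ∣ eval (L ℕ.+ k) p ∣      ≤⟨ ∣eval∣≤mass (L ℕ.+ k) p ⟩
  mass (L ℕ.+ k) p          ≤⟨ mass-growth L k b p (proj₁ rest) ⟩
  mass L p ℕ.* b ℕ.^ k      <⟨ ℕₚ.*-monoˡ-< (b ℕ.^ k) {{ℕₚ.m^n≢0 b k {{b≢0}}}} (ℕₚ.<ᵇ⇒< (mass L p) (a ℕ.* b ℕ.^ L) (proj₂ rest)) ⟩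
  a ℕ.* b ℕ.^ L ℕ.* b ℕ.^ k ≡⟨ ℕₚ.*-assoc a (b ℕ.^ L) (b ℕ.^ k) ⟩
  a ℕ.* (b ℕ.^ L ℕ.* b ℕ.^ k) ≡⟨ cong (a ℕ.*_) (ℕₚ.^-distribˡ-+-* b L k) ⟨
  a ℕ.* b ℕ.^ (L ℕ.+ k)     ∎
  where
  open ℕₚ.≤-Reasoning
  first = Equivalence.to T-∧ ok
  rest = Equivalence.to T-∧ (proj₂ first)
  b≢0 : ℕ.NonZero b
  b≢0 = ℕ.>-nonZero (ℕₚ.≤ᵇ⇒≤ 1 b (proj₁ first))

-- The flag is the expected negativity. That the head has the largest base is tested inside
-- `dominated`; the empty sum is zero and passes as nonnegative.
settled : ℕ → Bool → ExpSum → Bool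
settled L neg   []                   = not neg
settled L true  ((+ _      , b) ∷ p) = false
settled L true  ((-[1+ a ] , b) ∷ p) = dominated L (suc a) b p
settled L false ((-[1+ _ ] , b) ∷ p) = false
settled L false ((+ a      , b) ∷ p) = dominated L a b p

∣i∣<x⇒i<x : ∀ i {x} → ∣ i ∣ ℕ.< x → i ℤ.< + x
∣i∣<x⇒i<x (+ r)    r<x = +<+ r<x
∣i∣<x⇒i<x -[1+ r ] _   = -<+

settled-negative : ∀ L k p → T (settled L true p) → eval (L ℕ.+ k) p ℤ.< 0ℤ
settled-negative L k ((-[1+ a ] , b) ∷ p) ok = begin-strict
  -[1+ a ] * + B + R      ≡⟨ cong (λ y → y + R) (trans (sym (ℤₚ.neg-distribˡ-* (+ suc a) (+ B))) (cong -_ (sym (ℤₚ.pos-* (suc a) B)))) ⟩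
  - + (suc a ℕ.* B) + R   <⟨ ℤₚ.+-monoʳ-< (- + (suc a ℕ.* B)) (∣i∣<x⇒i<x R (dominated-sound L k (suc a) b p ok)) ⟩
  - + (suc a ℕ.* B) + + (suc a ℕ.* B) ≡⟨ ℤₚ.+-inverseˡ (+ (suc a ℕ.* B)) ⟩
  0ℤ ∎
  where
  open ℤₚ.≤-Reasoning
  B = b ℕ.^ (L ℕ.+ k)
  R = eval (L ℕ.+ k) p

settled-nonNegative : ∀ L k p → T (settled L false p) → 0ℤ ℤ.≤ eval (L ℕ.+ k) p
settled-nonNegative L k []                ok = ℤₚ.≤-refl
settled-nonNegative L k ((+ a , b) ∷ p)   ok = begin
  0ℤ                     ≡⟨ ℤₚ.+-inverseʳ R ⟨
  R + - R                ≤⟨ ℤₚ.<⇒≤ (ℤₚ.+-monoʳ-< R (∣i∣<x⇒i<x (- R) (subst (ℕ._< a ℕ.* B) (sym (ℤₚ.∣-i∣≡∣i∣ R)) (dominated-sound L k a b p ok)))) ⟩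
  R + + (a ℕ.* B)        ≡⟨ ℤₚ.+-comm R _ ⟩
  + (a ℕ.* B) + R        ≡⟨ cong (λ y → y + R) (ℤₚ.pos-* a B) ⟩
  + a * + B + R          ∎
  where
  open ℤₚ.≤-Reasoning
  B = b ℕ.^ (L ℕ.+ k)
  R = eval (L ℕ.+ k) p

-- Decidability and eventual constancy of the claimed sets

-- `E` yields bare types; these codes allow membership to be decided and its constancy from some ℓ
-- on to be tested.
data Shape : (ℕ → Set) → Set₁ where
  empty   : Shape (λ _ → ⊥)
  above   : ∀ k → Shape (λ ℓ → k ≤ ℓ)
  between : ∀ a b → Shape (λ ℓ → a ≤ ℓ × ℓ ≤ b)
  _∪_     : ∀ {P Q} → Shape P → Shape Q → Shape (λ ℓ → P ℓ ⊎ Q ℓ)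

shape-E : ∀ n → Shape (E n)
shape-E 0  = empty
shape-E 1  = above 2
shape-E 2  = empty
shape-E 3  = between 2 13
shape-E 4  = above 16
shape-E 5  = between 2 19
shape-E 6  = empty
shape-E 7  = above 2
shape-E 8  = between 15 26
shape-E 9  = between 2 12
shape-E 10 = above 22
shape-E 11 = between 2 35
shape-E 12 = empty
shape-E 13 = between 2 9 ∪ above 26
shape-E 14 = between 20 44
shape-E 15 = between 2 8
shape-E 16 = above 29
shape-E 17 = between 2 6 ∪ between 24 54
shape-E 18 = empty
shape-E 19 = between 2 4 ∪ above 32
shape-E 20 = above 27
-- `E` reduces to its default only once the argument is visibly at least 21.
shape-E (suc (suc (suc (suc (suc (suc (suc (suc (suc (suc (suc (suc (suc (suc (suc
  (suc (suc (suc (suc (suc (suc n))))))))))))))))))))) = empty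

shape-dec : ∀ {P} → Shape P → ∀ ℓ → Dec (P ℓ)
shape-dec empty         ℓ = no λ ()
shape-dec (above k)     ℓ = k ℕ.≤? ℓ
shape-dec (between a b) ℓ = (a ℕ.≤? ℓ) ×-dec (ℓ ℕ.≤? b)
shape-dec (s ∪ t)       ℓ = shape-dec s ℓ ⊎-dec shape-dec t ℓ

E? : ∀ n ℓ → Dec (E n ℓ)
E? n = shape-dec (shape-E n)

bounded : ∀ {P} → ℕ → Shape P → Bool
bounded L empty         = true
bounded L (above k)     = k ℕ.≤ᵇ L
bounded L (between a b) = b <ᵇ L
bounded L (s ∪ t)       = bounded L s ∧ bounded L t

bounded-sound : ∀ {P} (s : Shape P) L k → T (bounded L s) → P (L ℕ.+ k) ⇔ P L
bounded-sound empty         L k ok = mk⇔ (λ ()) (λ ())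
bounded-sound (above m)     L k ok = mk⇔ (λ _ → m≤L) (λ _ → ℕₚ.≤-trans m≤L (ℕₚ.m≤m+n L k))
  where m≤L = ℕₚ.≤ᵇ⇒≤ m L ok
bounded-sound (between a b) L k ok = mk⇔
  (λ (_ , L+k≤b) → contradiction (ℕₚ.≤-trans (ℕₚ.m≤m+n L k) L+k≤b) (ℕₚ.<⇒≱ b<L))
  (λ (_ , L≤b) → contradiction L≤b (ℕₚ.<⇒≱ b<L))
  where b<L = ℕₚ.<ᵇ⇒< b L ok
bounded-sound (s ∪ t)       L k ok =
  bounded-sound s L k (proj₁ both) ⊎-⇔ bounded-sound t L k (proj₂ both)
  where both = Equivalence.to T-∧ ok

-- The largest endpoint in the claim is 54, in `E 17`, so no membership changes from 55 on.
E-tail : ∀ n → n ≤ 20 → ∀ k → E n (55 ℕ.+ k) ⇔ E n 55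
E-tail n n≤20 k = bounded-sound (shape-E n) 55 k
  (from-yes (ℕₚ.allUpTo? (λ n → T? (bounded 55 (shape-E n))) 21) (ℕ.s≤s n≤20))

-- Failure at m + 1 of log-concavity of the sequence c n / n!, with
-- denominators cleared.
NotLogConcave : (ℕ → ℕ) → ℕ → Set
NotLogConcave c m =
  suc (suc m) ℕ.* (c (suc m) ℕ.* c (suc m)) ℕ.< suc m ℕ.* (c m ℕ.* c (suc (suc m)))

-- In a descending list ending at index 0, the tail after `r` has as many entries as the index of
-- `r`.
windows : {A : Set} → (ℕ → A → A → A → Bool) → List A → Bool
windows W (p ∷ q ∷ r ∷ rs) = W (length rs) p q r ∧ windows W (q ∷ r ∷ rs)
windows W _                = true

-- `R` is equality in the numerical check and `Represents ℓ` in the check for large ℓ.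
windows-sound : {A : Set} (R : A → ℕ → Set) (W : ℕ → A → A → A → Bool) (f : ℕ → ℕ) → ∀ N {ps} →
  Pointwise R ps (down f (suc (suc N))) → T (windows W ps) → ∀ m → m ≤ N →
  ∃ λ p → ∃ λ q → ∃ λ r → R p (f (suc (suc m))) × R q (f (suc m)) × R r (f m) × T (W m p q r)
windows-sound R W f zero    (rp ∷ rq ∷ rr ∷ [])  ok zero _ =
  _ , _ , _ , rp , rq , rr , proj₁ (Equivalence.to T-∧ ok)
windows-sound R W f (suc N) {p ∷ q ∷ r ∷ _} (rp ∷ rq ∷ rr ∷ rrs) ok m m≤N =
  case ℕₚ.m≤n⇒m<n∨m≡n m≤N of λ where
    (inj₁ m<N)  → windows-sound R W f N (rq ∷ rr ∷ rrs) (proj₂ (Equivalence.to T-∧ ok)) m (ℕₚ.≤-pred m<N)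
    (inj₂ refl) → p , q , r , rp , rq , rr ,
      subst (λ k → T (W k p q r)) (trans (Pointwise-length rrs) (length-down f N)) (proj₁ (Equivalence.to T-∧ ok))

windows-down : (W : ℕ → ℕ → ℕ → ℕ → Bool) (f : ℕ → ℕ) → ∀ N → T (windows W (down f (suc (suc N)))) →
               ∀ m → m ≤ N → T (W m (f (suc (suc m))) (f (suc m)) (f m))
windows-down W f N ok m m≤N with windows-sound _≡_ W f N (Pointwise.refl refl) ok m m≤N
... | _ , _ , _ , refl , refl , refl , ok′ = ok′

agree : Bool → Bool → Bool
agree true  b = b
agree false b = not b

agree-sound : ∀ {P : Set} (P? : Dec P) x y → T (agree (does P?) (x <ᵇ y)) → (x ℕ.< y ⇔ P)
agree-sound (yes p) x y ok = mk⇔ (λ _ → p) (λ _ → ℕₚ.<ᵇ⇒< x y ok)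
agree-sound (no ¬p) x y ok = mk⇔ (λ x<y → contradiction ok (¬ok (Equivalence.to T-≡ (ℕₚ.<⇒<ᵇ x<y)))) (λ p → contradiction p ¬p)
  where
  ¬ok : (x <ᵇ y) ≡ true → ¬ T (not (x <ᵇ y))
  ¬ok eq rewrite eq = λ ()

-- Small ℓ

numericWindow : ℕ → ℕ → ℕ → ℕ → ℕ → Bool
numericWindow ℓ m p q r =
  agree (does (E? (suc m) ℓ)) (suc (suc m) ℕ.* (q ℕ.* q) <ᵇ suc m ℕ.* (r ℕ.* p))

dot : List ℕ → List ℕ → ℕ
dot (w ∷ ws) (x ∷ xs) = w ℕ.* x ℕ.+ dot ws xs
dot _        _        = 0

dot-tabulate : ∀ {n} (w x : Fin n → ℕ) → dot (List.tabulate w) (List.tabulate x) ≡ sum (λ i → w i ℕ.* x i)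
dot-tabulate {zero}  w x = refl
dot-tabulate {suc n} w x = cong (w zero ℕ.* x zero ℕ.+_) (dot-tabulate (w ∘ suc) (x ∘ suc))

-- `row` holds the sublattice counts for ℓ; one multiplication by the divisor matrix `ws` gives
-- those for ℓ + 1, instead of unfolding `latCount` from scratch.
checkRows : ℕ → List (List ℕ) → ℕ → ℕ → List ℕ → Bool
checkRows N ws zero    ℓ row = true
checkRows N ws (suc k) ℓ row =
  windows (numericWindow ℓ) (ℕ-Ops.build 1 row N) ∧ checkRows N ws k (suc ℓ) (map (λ w → dot w row) ws)

build-counts : ∀ ℓ {b N} → N ≤ suc b →
               ℕ-Ops.build 1 (List.tabulate (latCount (suc b) ℓ)) N ≡ down (count ℓ) N
build-counts ℓ {b} {N} N≤B = trans
  (cong (λ c₀ → ℕ-Ops.build c₀ (List.tabulate (latCount (suc b) ℓ)) N) (sym (count-zero ℓ)))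
  (build-down (count ℓ) (latCount (suc b) ℓ) (λ n n<N → count-suc ℓ (ℕₚ.≤-pred (ℕₚ.≤-trans n<N N≤B))))

checkRows-sound : ∀ {b N} → N ≤ suc b → ∀ k ℓ →
  T (checkRows N (List.tabulate (λ d → List.tabulate (divisorWeight (suc b) d))) k ℓ
               (List.tabulate (latCount (suc b) ℓ))) →
  ∀ i → i ℕ.< k → T (windows (numericWindow (i ℕ.+ ℓ)) (down (count (i ℕ.+ ℓ)) N))
checkRows-sound {b} {N} N≤B (suc k) ℓ ok zero    _ =
  subst (T ∘ windows (numericWindow ℓ)) (build-counts ℓ N≤B) (proj₁ (Equivalence.to T-∧ ok))
checkRows-sound {b} {N} N≤B (suc k) ℓ ok (suc i) (ℕ.s≤s i<k) =
  subst (λ ℓ → T (windows (numericWindow ℓ) (down (count ℓ) N))) (ℕₚ.+-suc i ℓ)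
    (checkRows-sound N≤B k (suc ℓ)
      (subst (λ row → T (checkRows N ws k (suc ℓ) row)) next (proj₂ (Equivalence.to T-∧ ok))) i i<k)
  where
  ws  = List.tabulate (λ d → List.tabulate (divisorWeight (suc b) d))
  row = List.tabulate (latCount (suc b) ℓ)
  next : map (λ w → dot w row) ws ≡ List.tabulate (latCount (suc b) (suc ℓ))
  next = trans (Listₚ.map-tabulate (λ d → List.tabulate (divisorWeight (suc b) d)) (λ w → dot w row))
    (Listₚ.tabulate-cong (λ d → dot-tabulate (divisorWeight (suc b) d) (latCount (suc b) ℓ)))

-- Evaluation covers ℓ = 1, ..., 54. Counts up to 21 points enter because Δ at n = 20 involves n +
-- 1.
rows-check : checkRows 21 (List.tabulate (λ d → List.tabulate (divisorWeight 21 d))) 54 1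
                          (List.tabulate (latCount 21 1)) ≡ true
rows-check = refl

notLogConcave-small : ∀ m → suc m ≤ 20 → ∀ i → i ℕ.< 54 →
                      NotLogConcave (count (i ℕ.+ 1)) m ⇔ E (suc m) (i ℕ.+ 1)
notLogConcave-small m m<20 i i<54 = agree-sound (E? (suc m) (i ℕ.+ 1))
  (suc (suc m) ℕ.* (c (suc m) ℕ.* c (suc m))) (suc m ℕ.* (c m ℕ.* c (suc (suc m))))
  (windows-down (numericWindow (i ℕ.+ 1)) c 19
    (checkRows-sound {20} {21} ℕₚ.≤-refl 54 1 (Equivalence.from T-≡ rows-check) i i<54) m (ℕₚ.≤-pred m<20))
  where c = count (i ℕ.+ 1)

-- Large ℓ

eval-null : ∀ ℓ p → T (null p) → eval ℓ p ≡ + 0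
eval-null ℓ [] _ = refl

-- If all terms cancel, the recurrence of `latCount` holds for every ℓ simultaneously.
defect : ∀ {b} → (Fin b → ExpSum) → Fin b → ExpSum
defect {b} G d = shift (G d) ⊞ scale (- + 1) (ES.combination (divisorWeight b d) G)

-- `G d` already carries one factor `S`, so `toℕ d` more make the weight equal to the index
-- `suc (toℕ d)`.
scaledGens : ∀ {n} → ℕ → (Fin n → ExpSum) → List ExpSum
scaledGens S G = List.tabulate (λ d → scale (+ (S ℕ.^ toℕ d)) (G d))

scaledCount : ℕ → ℕ → ℕ → ℕ
scaledCount S ℓ m = S ℕ.^ m ℕ.* count ℓ m

module _ {b : ℕ} (S : ℕ) (G : Fin (suc b) → ExpSum)
         (at-zero : ∀ d → eval 0 (G d) ≡ + (S ℕ.* latCount (suc b) 0 d))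
         (recurrent : ∀ d → T (null (defect G d))) where

  -- The value at ℓ = 0 and the recurrence determine the counts, so any proposed table of
  -- coefficients is verified by two finite checks.
  represents-latCount : ∀ ℓ d → Represents ℓ (G d) (S ℕ.* latCount (suc b) ℓ d)
  represents-latCount zero    d = at-zero d
  represents-latCount (suc ℓ) d = begin
    eval (suc ℓ) (G d)                        ≡⟨ eval-shift ℓ (G d) ⟨
    eval ℓ (shift (G d))                      ≡⟨ solve 2 (λ x y → x := (x :+ con (- + 1) :* y) :+ y) refl (eval ℓ (shift (G d))) (eval ℓ K) ⟩
    (eval ℓ (shift (G d)) ℤ.+ (- + 1) ℤ.* eval ℓ K) ℤ.+ eval ℓ K
      ≡⟨ cong (λ y → (eval ℓ (shift (G d)) ℤ.+ y) ℤ.+ eval ℓ K) (eval-scale ℓ (- + 1) K) ⟨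
    (eval ℓ (shift (G d)) ℤ.+ eval ℓ (scale (- + 1) K)) ℤ.+ eval ℓ K
      ≡⟨ cong (λ y → y ℤ.+ eval ℓ K) (eval-⊞ ℓ (shift (G d)) (scale (- + 1) K)) ⟨
    eval ℓ (defect G d) ℤ.+ eval ℓ K        ≡⟨ cong (λ y → y ℤ.+ eval ℓ K) (eval-null ℓ (defect G d) (recurrent d)) ⟩
    + 0 ℤ.+ eval ℓ K                      ≡⟨ ℤₚ.+-identityˡ (eval ℓ K) ⟩
    eval ℓ K                              ≡⟨ represents-combination ℓ w G (λ e → S ℕ.* g e) (represents-latCount ℓ) ⟩
    + sum (λ e → w e ℕ.* (S ℕ.* g e))  ≡⟨ cong +_ (sum-cong-≗ (λ e → swap (w e) S (g e))) ⟩
    + sum (λ e → S ℕ.* (w e ℕ.* g e))  ≡⟨ cong +_ (*-distribˡ-sum S (λ e → w e ℕ.* g e)) ⟨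
    + (S ℕ.* latCount (suc b) (suc ℓ) d)    ∎
    where
    open ≡-Reasoning
    open ℤSolver.+-*-Solver
    w = divisorWeight (suc b) d
    g = latCount (suc b) ℓ
    K = ES.combination w G
    swap : ∀ x y z → x ℕ.* (y ℕ.* z) ≡ y ℕ.* (x ℕ.* z)
    swap x y z = trans (sym (ℕₚ.*-assoc x y z)) (trans (cong (λ u → u ℕ.* z) (ℕₚ.*-comm x y)) (ℕₚ.*-assoc y x z))

  represents-scaledCount : ∀ ℓ {N} → N ≤ suc b →
    Pointwise (Represents ℓ) (ES.build ((+ 1 , 1) ∷ []) (scaledGens S G) N) (down (scaledCount S ℓ) N)
  represents-scaledCount ℓ {N} N≤B = subst (Pointwise (Represents ℓ) (ES.build ((+ 1 , 1) ∷ []) (scaledGens S G) N))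
    (build-down (scaledCount S ℓ) (λ d → S ℕ.^ suc (toℕ d) ℕ.* latCount (suc b) ℓ d)
      (λ n n<N → scaled-rec S (count ℓ) (latCount (suc b) ℓ) n (count-suc ℓ (ℕₚ.≤-pred (ℕₚ.≤-trans n<N N≤B)))))
    (represents-build ℓ one (Pointwise.tabulate⁺ {f = λ d → scale (+ (S ℕ.^ toℕ d)) (G d)} gens) N)
    where
    one : Represents ℓ ((+ 1 , 1) ∷ []) (scaledCount S ℓ 0)
    one = trans (cong (λ x → (+ 1 ℤ.* + x) ℤ.+ + 0) (ℕₚ.^-zeroˡ ℓ)) (cong (λ x → + (1 ℕ.* x)) (sym (count-zero ℓ)))
    gens : ∀ d → Represents ℓ (scale (+ (S ℕ.^ toℕ d)) (G d)) (S ℕ.^ suc (toℕ d) ℕ.* latCount (suc b) ℓ d)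
    gens d = trans (represents-⊙ ℓ {G d} (S ℕ.^ toℕ d) (represents-latCount ℓ d))
      (cong +_ (move (S ℕ.^ toℕ d) S (latCount (suc b) ℓ d)))
      where
      move : ∀ x y z → x ℕ.* (y ℕ.* z) ≡ y ℕ.* x ℕ.* z
      move x y z = trans (sym (ℕₚ.*-assoc x y z)) (cong (λ u → u ℕ.* z) (ℕₚ.*-comm x y))

gap : ℕ → ExpSum → ExpSum → ExpSum → ExpSum
gap m p q r = scale (+ suc (suc m)) (q ⊠ q) ⊞ scale (- + suc m) (r ⊠ p)

tailWindow : ℕ → ℕ → ExpSum → ExpSum → ExpSum → Bool
tailWindow L m p q r = settled L (does (E? (suc m) L)) (gap m p q r)

eval-gap : ∀ ℓ m {p q r x y z} → Represents ℓ p x → Represents ℓ q y → Represents ℓ r z →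
           eval ℓ (gap m p q r) ≡ + (suc (suc m) ℕ.* (y ℕ.* y)) ℤ.- + (suc m ℕ.* (z ℕ.* x))
eval-gap ℓ m {p} {q} {r} {x} {y} {z} rp rq rr =
  trans (eval-⊞ ℓ (scale (+ suc (suc m)) (q ⊠ q)) (scale (- + suc m) (r ⊠ p)))
    (cong₂ ℤ._+_
      (represents-⊙ ℓ {q ⊠ q} (suc (suc m)) (represents-⊠ ℓ {q} {q} rq rq))
      (trans (eval-scale ℓ (- + suc m) (r ⊠ p))
        (trans (cong ((- + suc m) ℤ.*_) (represents-⊠ ℓ {r} {p} rr rp))
          (trans (sym (ℤₚ.neg-distribˡ-* (+ suc m) (+ (z ℕ.* x)))) (cong -_ (sym (ℤₚ.pos-* (suc m) (z ℕ.* x))))))))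

settled-sound : ∀ {P : Set} (P? : Dec P) L k p x y → eval (L ℕ.+ k) p ≡ + x ℤ.- + y →
                T (settled L (does P?) p) → (x ℕ.< y ⇔ P)
settled-sound (yes pf) L k p x y eq ok = mk⇔ (λ _ → pf) (λ _ → ℤₚ.drop‿+<+ (subst₂ ℤ._<_
  (trans (ℤₚ.+-assoc (+ x) (- + y) (+ y)) (trans (cong (λ i → + x ℤ.+ i) (ℤₚ.+-inverseˡ (+ y))) (ℤₚ.+-identityʳ (+ x))))
  (ℤₚ.+-identityˡ (+ y))
  (ℤₚ.+-monoˡ-< (+ y) (subst (ℤ._< + 0) eq (settled-negative L k p ok)))))
settled-sound (no ¬pf) L k p x y eq ok = mk⇔
  (λ x<y → contradiction
    (ℤₚ.drop‿+≤+ (ℤₚ.0≤i-j⇒j≤i (subst (+ 0 ℤ.≤_) eq (settled-nonNegative L k p ok))))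
    (ℕₚ.<⇒≱ x<y))
  (λ pf → contradiction pf ¬pf)

-- Both sides carry the same power of `S`, as (m + 1) + (m + 1) = m + (m + 2).
scaled-notLogConcave : ∀ S .{{_ : ℕ.NonZero S}} ℓ m → NotLogConcave (scaledCount S ℓ) m ⇔ NotLogConcave (count ℓ) m
scaled-notLogConcave S ℓ m = mk⇔
  (λ lt → ℕₚ.*-cancelˡ-< F _ _ (subst₂ ℕ._<_ left right lt))
  (λ lt → subst₂ ℕ._<_ (sym left) (sym right) (ℕₚ.*-monoʳ-< F {{F≢0}} lt))
  where
  open ℕSolver.+-*-Solver
  x = S ℕ.^ m
  F = (S ℕ.* x) ℕ.* (S ℕ.* x)
  F≢0 : ℕ.NonZero F
  F≢0 = ℕₚ.m*n≢0 (S ℕ.* x) (S ℕ.* x) {{ℕₚ.m^n≢0 S (suc m)}} {{ℕₚ.m^n≢0 S (suc m)}}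
  c = count ℓ
  left : suc (suc m) ℕ.* (scaledCount S ℓ (suc m) ℕ.* scaledCount S ℓ (suc m)) ≡ F ℕ.* (suc (suc m) ℕ.* (c (suc m) ℕ.* c (suc m)))
  left = solve 4 (λ n s x q → n :* (((s :* x) :* q) :* ((s :* x) :* q)) := (s :* x) :* (s :* x) :* (n :* (q :* q))) refl
    (suc (suc m)) S x (c (suc m))
  right : suc m ℕ.* (scaledCount S ℓ m ℕ.* scaledCount S ℓ (suc (suc m))) ≡ F ℕ.* (suc m ℕ.* (c m ℕ.* c (suc (suc m))))
  right = solve 5 (λ n s x r p → n :* ((x :* r) :* ((s :* (s :* x)) :* p)) := (s :* x) :* (s :* x) :* (n :* (r :* p))) refl
    (suc m) S x (c m) (c (suc (suc m)))

module _ {b : ℕ} (S : ℕ) .{{_ : ℕ.NonZero S}} (G : Fin (suc b) → ExpSum)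
         (at-zero : ∀ d → eval 0 (G d) ≡ + (S ℕ.* latCount (suc b) 0 d))
         (recurrent : ∀ d → T (null (defect G d))) where

  notLogConcave-settled : ∀ L N → suc (suc N) ≤ suc b →
    windows (tailWindow L) (ES.build ((+ 1 , 1) ∷ []) (scaledGens S G) (suc (suc N))) ≡ true →
    ∀ m → m ≤ N → ∀ k → NotLogConcave (count (L ℕ.+ k)) m ⇔ E (suc m) L
  notLogConcave-settled L N N≤b ok m m≤N k = fromWindow
    (windows-sound (Represents ℓ) (tailWindow L) (scaledCount S ℓ) N
      (represents-scaledCount S G at-zero recurrent ℓ N≤b) (Equivalence.from T-≡ ok) m m≤N)
    where
    ℓ = L ℕ.+ k
    fromWindow : (∃ λ p → ∃ λ q → ∃ λ r → Represents ℓ p (scaledCount S ℓ (suc (suc m)))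
                   × Represents ℓ q (scaledCount S ℓ (suc m))
                   × Represents ℓ r (scaledCount S ℓ m) × T (tailWindow L m p q r)) →
                 NotLogConcave (count ℓ) m ⇔ E (suc m) L
    fromWindow (p , q , r , rp , rq , rr , ok) = mk⇔
      (Equivalence.to sign ∘ Equivalence.from unscale) (Equivalence.to unscale ∘ Equivalence.from sign)
      where
      unscale = scaled-notLogConcave S ℓ m
      sign : NotLogConcave (scaledCount S ℓ) m ⇔ E (suc m) L
      sign = settled-sound (E? (suc m) L) L k (gap m p q r) _ _ (eval-gap ℓ m {p} {q} {r} rp rq rr) ok

-- Entry d - 1 represents 5040 times the number of sublattices of ℤ^ℓ of index d;
-- 5040 is the common denominator of the coefficients for d ≤ 21.
latExpSums : Vec ExpSum 21
latExpSums =
    ((+ 5040 , 1) ∷ [])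
  ∷ ((+ 5040 , 2) ∷ (- + 5040 , 1) ∷ [])
  ∷ ((+ 2520 , 3) ∷ (- + 2520 , 1) ∷ [])
  ∷ ((+ 3360 , 4) ∷ (- + 5040 , 2) ∷ (+ 1680 , 1) ∷ [])
  ∷ ((+ 1260 , 5) ∷ (- + 1260 , 1) ∷ [])
  ∷ ((+ 2520 , 6) ∷ (- + 2520 , 3) ∷ (- + 2520 , 2) ∷ (+ 2520 , 1) ∷ [])
  ∷ ((+ 840 , 7) ∷ (- + 840 , 1) ∷ [])
  ∷ ((+ 1920 , 8) ∷ (- + 3360 , 4) ∷ (+ 1680 , 2) ∷ (- + 240 , 1) ∷ [])
  ∷ ((+ 945 , 9) ∷ (- + 1260 , 3) ∷ (+ 315 , 1) ∷ [])
  ∷ ((+ 1260 , 10) ∷ (- + 1260 , 5) ∷ (- + 1260 , 2) ∷ (+ 1260 , 1) ∷ [])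
  ∷ ((+ 504 , 11) ∷ (- + 504 , 1) ∷ [])
  ∷ ((+ 1680 , 12) ∷ (- + 2520 , 6) ∷ (- + 1680 , 4) ∷ (+ 840 , 3) ∷ (+ 2520 , 2) ∷ (- + 840 , 1) ∷ [])
  ∷ ((+ 420 , 13) ∷ (- + 420 , 1) ∷ [])
  ∷ ((+ 840 , 14) ∷ (- + 840 , 7) ∷ (- + 840 , 2) ∷ (+ 840 , 1) ∷ [])
  ∷ ((+ 630 , 15) ∷ (- + 630 , 5) ∷ (- + 630 , 3) ∷ (+ 630 , 1) ∷ [])
  ∷ ((+ 1024 , 16) ∷ (- + 1920 , 8) ∷ (+ 1120 , 4) ∷ (- + 240 , 2) ∷ (+ 16 , 1) ∷ [])
  ∷ ((+ 315 , 17) ∷ (- + 315 , 1) ∷ [])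
  ∷ ((+ 945 , 18) ∷ (- + 945 , 9) ∷ (- + 1260 , 6) ∷ (+ 1260 , 3) ∷ (+ 315 , 2) ∷ (- + 315 , 1) ∷ [])
  ∷ ((+ 280 , 19) ∷ (- + 280 , 1) ∷ [])
  ∷ ((+ 840 , 20) ∷ (- + 1260 , 10) ∷ (+ 420 , 5) ∷ (- + 840 , 4) ∷ (+ 1260 , 2) ∷ (- + 420 , 1) ∷ [])
  ∷ ((+ 420 , 21) ∷ (- + 420 , 7) ∷ (- + 420 , 3) ∷ (+ 420 , 1) ∷ [])
  ∷ []


-- ℤ^0 has one sublattice, of index 1: the coefficients of every later row add up to zero.
latExpSums-zero : ∀ d → eval 0 (lookup latExpSums d) ≡ + (5040 ℕ.* latCount 21 0 d)
latExpSums-zero = from-yes (Finₚ.all? (λ d → eval 0 (lookup latExpSums d) ℤ.≟ + (5040 ℕ.* latCount 21 0 d)))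

latExpSums-recurrent : ∀ d → T (null (defect (lookup latExpSums) d))
latExpSums-recurrent = from-yes (Finₚ.all? (λ d → T? (null (defect (lookup latExpSums) d))))

-- For each n ≤ 20 this evaluates the domination test at ℓ = 55 alone; `mass-growth` extends it to
-- all larger ℓ.
tail-check : windows (tailWindow 55) (ES.build ((+ 1 , 1) ∷ []) (scaledGens 5040 (lookup latExpSums)) (suc (suc 19))) ≡ true
tail-check = refl

notLogConcave-large : ∀ m → suc m ≤ 20 → ∀ k →
                      NotLogConcave (count (55 ℕ.+ k)) m ⇔ E (suc m) (55 ℕ.+ k)
notLogConcave-large m m<20 k = mk⇔
  (Equivalence.from (E-tail (suc m) m<20 k) ∘ Equivalence.to at-55)
  (Equivalence.from at-55 ∘ Equivalence.to (E-tail (suc m) m<20 k))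
  where
  at-55 = notLogConcave-settled 5040 (lookup latExpSums) latExpSums-zero latExpSums-recurrent
            55 19 ℕₚ.≤-refl tail-check m (ℕₚ.≤-pred m<20) k

notLogConcave⇔E : ∀ m → suc m ≤ 20 → ∀ ℓ → 1 ≤ ℓ → NotLogConcave (count ℓ) m ⇔ E (suc m) ℓ
notLogConcave⇔E m m<20 ℓ 1≤ℓ with ℓ ℕ.≤? 54
... | yes ℓ≤54 = subst (λ ℓ → NotLogConcave (count ℓ) m ⇔ E (suc m) ℓ) (ℕₚ.m∸n+n≡m 1≤ℓ)
  (notLogConcave-small m m<20 (ℓ ℕ.∸ 1) (ℕₚ.≤-trans (ℕₚ.≤-reflexive (trans (ℕₚ.+-comm 1 (ℓ ℕ.∸ 1)) (ℕₚ.m∸n+n≡m 1≤ℓ))) ℓ≤54))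
... | no  ℓ≰54 = subst (λ ℓ → NotLogConcave (count ℓ) m ⇔ E (suc m) ℓ) (ℕₚ.m+[n∸m]≡n (ℕₚ.≰⇒> ℓ≰54))
  (notLogConcave-large m m<20 (ℓ ℕ.∸ 55))

-- Clearing the denominators in Δ

toℚᵘ-/ : ∀ i d .{{_ : ℕ.NonZero d}} → toℚᵘ (i ℚ./ d) ℚᵘ.≃ (i ℚᵘ./ d)
toℚᵘ-/ i (suc d) = ℚₚ.toℚᵘ-fromℚᵘ (mkℚᵘ i d)

/-cancel-< : ∀ a A b B .{{_ : ℕ.NonZero A}} .{{_ : ℕ.NonZero B}} →
             ((+ a) ℚᵘ./ A) ℚᵘ.< ((+ b) ℚᵘ./ B) → a ℕ.* B ℕ.< b ℕ.* A
/-cancel-< a (suc A) b (suc B) (*<* lt) = ℤₚ.drop‿+<+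
  (subst₂ ℤ._<_ (sym (ℤₚ.pos-* a (suc B))) (sym (ℤₚ.pos-* b (suc A))) lt)

/-mono-< : ∀ a A b B .{{_ : ℕ.NonZero A}} .{{_ : ℕ.NonZero B}} →
           a ℕ.* B ℕ.< b ℕ.* A → ((+ a) ℚᵘ./ A) ℚᵘ.< ((+ b) ℚᵘ./ B)
/-mono-< a (suc A) b (suc B) lt = *<*
  (subst₂ ℤ._<_ (ℤₚ.pos-* a (suc B)) (ℤₚ.pos-* b (suc A)) (+<+ lt))

/-* : ∀ a A b B .{{_ : ℕ.NonZero A}} .{{_ : ℕ.NonZero B}} →
      ((+ a) ℚᵘ./ A) ℚᵘ.* ((+ b) ℚᵘ./ B) ≡ ((+ (a ℕ.* b)) ℚᵘ./ (A ℕ.* B)) {{ℕₚ.m*n≢0 A B}}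
/-* a (suc A) b (suc B) = cong (λ i → mkℚᵘ i _) (sym (ℤₚ.pos-* a b))

N-fraction : ∀ ℓ n → toℚᵘ (N ℓ n) ℚᵘ.≃ ((+ count ℓ n) ℚᵘ./ (n !)) {{n !≢0}}
N-fraction ℓ zero    = *≡* (cong (λ c → + c ℤ.* + 1) (sym (count-zero ℓ)))
N-fraction ℓ (suc n) = toℚᵘ-/ (+ length (C ℓ (suc n))) (suc n !) {{suc n !≢0}}

N-product : ∀ ℓ m n → toℚᵘ (N ℓ m ℚ.* N ℓ n) ℚᵘ.≃
            ((+ (count ℓ m ℕ.* count ℓ n)) ℚᵘ./ (m ! ℕ.* n !)) {{ℕₚ.m*n≢0 (m !) (n !) {{m !≢0}} {{n !≢0}}}}
N-product ℓ m n = ℚᵘₚ.≃-trans (ℚₚ.toℚᵘ-homo-* (N ℓ m) (N ℓ n))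
  (ℚᵘₚ.≃-trans (ℚᵘₚ.*-cong (N-fraction ℓ m) (N-fraction ℓ n))
    (ℚᵘₚ.≃-reflexive (/-* (count ℓ m) (m !) (count ℓ n) (n !) {{m !≢0}} {{n !≢0}})))

p-q<0⇔p<q : ∀ p q → (p ℚ.- q < 0ℚ) ⇔ (p < q)
p-q<0⇔p<q p q = mk⇔
  (λ lt → subst₂ _<_ (trans (ℚₚ.+-assoc p (ℚ.- q) q) (trans (cong (p ℚ.+_) (ℚₚ.+-inverseˡ q)) (ℚₚ.+-identityʳ p)))
                     (ℚₚ.+-identityˡ q) (ℚₚ.+-monoˡ-< q lt))
  (λ lt → subst (p ℚ.- q <_) (ℚₚ.+-inverseʳ q) (ℚₚ.+-monoˡ-< (ℚ.- q) lt))

-- Cross-multiplication brings in m! · (m + 2)! and (m + 1)!². Removing the common factor `F` = m! ·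
-- (m + 1)! leaves m + 2 and m + 1.
Δ<0⇔notLogConcave : ∀ ℓ m → (Δ ℓ (suc m) < 0ℚ) ⇔ NotLogConcave (count ℓ) m
Δ<0⇔notLogConcave ℓ m = mk⇔
  (λ lt → ℕₚ.*-cancelʳ-< F _ _ (subst₂ ℕ._<_ left right
    (/-cancel-< (c (suc m) ℕ.* c (suc m)) (f (suc m) ℕ.* f (suc m)) (c m ℕ.* c (suc (suc m))) (f m ℕ.* f (suc (suc m)))
      {{nz (suc m) (suc m)}} {{nz m (suc (suc m))}}
      (ℚᵘₚ.<-respʳ-≃ (N-product ℓ m (suc (suc m))) (ℚᵘₚ.<-respˡ-≃ (N-product ℓ (suc m) (suc m))
        (ℚₚ.toℚᵘ-mono-< (Equivalence.to (p-q<0⇔p<q _ _) lt)))))))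
  (λ lt → Equivalence.from (p-q<0⇔p<q _ _) (ℚₚ.toℚᵘ-cancel-<
    (ℚᵘₚ.<-respʳ-≃ (ℚᵘₚ.≃-sym (N-product ℓ m (suc (suc m)))) (ℚᵘₚ.<-respˡ-≃ (ℚᵘₚ.≃-sym (N-product ℓ (suc m) (suc m)))
      (/-mono-< (c (suc m) ℕ.* c (suc m)) (f (suc m) ℕ.* f (suc m)) (c m ℕ.* c (suc (suc m))) (f m ℕ.* f (suc (suc m)))
        {{nz (suc m) (suc m)}} {{nz m (suc (suc m))}}
        (subst₂ ℕ._<_ (sym left) (sym right) (ℕₚ.*-monoˡ-< F {{nz m (suc m)}} lt)))))))
  where
  open ℕSolver.+-*-Solver
  c = count ℓ
  f = _!
  F = f m ℕ.* f (suc m)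
  nz : ∀ a b → ℕ.NonZero (a ! ℕ.* b !)
  nz a b = ℕₚ.m*n≢0 (a !) (b !) {{a !≢0}} {{b !≢0}}
  left : (c (suc m) ℕ.* c (suc m)) ℕ.* (f m ℕ.* f (suc (suc m))) ≡ (suc (suc m) ℕ.* (c (suc m) ℕ.* c (suc m))) ℕ.* F
  left = solve 4 (λ x y k z → x :* (y :* (k :* z)) := k :* x :* (y :* z)) refl
    (c (suc m) ℕ.* c (suc m)) (f m) (suc (suc m)) (f (suc m))
  right : (c m ℕ.* c (suc (suc m))) ℕ.* (f (suc m) ℕ.* f (suc m)) ≡ (suc m ℕ.* (c m ℕ.* c (suc (suc m)))) ℕ.* F
  right = solve 4 (λ x k y z → x :* (k :* y :* z) := k :* x :* (y :* z)) refl
    (c m ℕ.* c (suc (suc m))) (suc m) (f m) (f (suc m))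

theorem1p4 : (n : ℕ) → 1 ≤ n → n ≤ 20 → (ℓ : ℕ) → 1 ≤ ℓ → (Δ ℓ n < 0ℚ ⇔ E n ℓ)
theorem1p4 (suc m) _ n≤20 ℓ 1≤ℓ = mk⇔
  (Equivalence.to claim ∘ Equivalence.to cleared) (Equivalence.from cleared ∘ Equivalence.from claim)
  where
  cleared = Δ<0⇔notLogConcave ℓ m
  claim   = notLogConcave⇔E m n≤20 ℓ 1≤ℓ
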